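{- Let $\mathcal{C}$ be a covering of a finite set $U$ with $|U|=m$, such that there are no two distinct elements $u,v\in U$ with $\mathcal{C}(\{u\})=\mathcal{C}(\{v\})$ and $|\mathcal{C}(\{u\})|=1$. Let $\mathcal{L}$ be a uniform lattice with $L(\mathcal{C})\cong\mathcal{L}$, and suppose $|L^{(2)}(\mathcal{C})|<\binom{m}{2}$. If $\pi$ is an atom of $\mathcal{L}$, then $$|\mathcal{L}^{(2)}|=|L^{(2)}(\mathcal{C})|=\binom{|\mathcal{L}^{(1)}|}{2}-\left(\binom{|\mathcal{L}^{(1)}|-|\operatorname{Cov}(\pi)|+1}{2}-1\right)\cdot\frac{|\mathcal{L}^{(1)}|}{|\mathcal{L}^{(1)}|-|\operatorname{Cov}(\pi)|+1}.$$
   Context: A covering of a finite set $U$ is a collection $\mathcal{C}\subseteq 2^U$ of subsets of $U$ whose union is $U$. For $H\subseteq U$, $\mathcal{C}(H):=\{C\in\mathcal{C} : C\cap H\neq\emptyset\}$. The matroid $M(\mathcal{C})$ is the transversal matroid of $\mathcal{C}$ on the ground set $U$: its independent sets are the partial transversals of $\mathcal{C}$, i.e. the sets $I\subseteq U$ for which there is an injective map $\varphi:I\to\mathcal{C}$ with $e\in\varphi(e)$ for all $e\in I$. $L(\mathcal{C})$ is the lattice of closed sets (flats) of $M(\mathcal{C})$ ordered by inclusion. For a ranked lattice $\mathcal{L}$ with rank function $\operatorname{rk}$ (the height above the minimum element), $\mathcal{L}^{(\ell)}$ is the set of elements of rank $\ell$ (similarly $L^{(\ell)}(\mathcal{C})$),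 and $\operatorname{Cov}(y)$ is the set of elements covering $y$. $\mathcal{L}$ is uniform if $\operatorname{rk}(y)=\operatorname{rk}(z)$ implies $|\operatorname{Cov}(y)|=|\operatorname{Cov}(z)|$. -}

module Defs where

open import Level using (Level; _⊔_)
open import Data.Fin.Base using (Fin)
open import Data.Fin.Subset using (Subset; ∣_∣; Nonempty; ⁅_⁆; _∪_; _∩_; _⊆_) renaming (_∈_ to _∈ₛ_)
open import Data.Fin.Subset.Properties using (⊆-poset)
open import Data.Integer.Base using (+_)
open import Data.Nat.Base using (ℕ; zero; suc; _≤_)
open import Data.Product.Base using (Σ-syntax; ∃-syntax; _×_; proj₁)
open import Data.Rational.Base using (ℚ; _/_)
open import Function.Bundles using (Inverse; Injection)
open import Relation.Binary.Bundles using (Setoid; Poset)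
import Relation.Binary.Construct.On as On
import Relation.Binary.Construct.NonStrictToStrict as ToStrict
open import Relation.Binary.Definitions using (Minimum)
open import Relation.Binary.Lattice.Bundles using (Lattice)
open import Relation.Binary.Morphism.Structures using (IsOrderIsomorphism)
open import Relation.Binary.PropositionalEquality.Core using (_≡_)
import Relation.Binary.PropositionalEquality.Properties as ≡
open import Relation.Nullary.Negation.Core using (¬_)
open import Relation.Unary using (Pred; _∈_; _≐_)

private
  variable
    a b p q ℓ ℓ₁ ℓ₂ : Level
    m : ℕ

ι : ℕ → ℚ
ι n = + n / 1

-- Membership proofs are ignored: elements are compared in S only.
⟪_∣_⟫ : (S : Setoid a ℓ) → Pred (Setoid.Carrier S) p → Setoid (a ⊔ p) ℓ
⟪ S ∣ P ⟫ = On.setoid S (proj₁ {B = P})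

Equinumerous : (S : Setoid a ℓ) → Pred (Setoid.Carrier S) p → Pred (Setoid.Carrier S) q → Set _
Equinumerous S P Q = Inverse ⟪ S ∣ P ⟫ ⟪ S ∣ Q ⟫

HasCard : (S : Setoid a ℓ) → Pred (Setoid.Carrier S) p → ℕ → Set _
HasCard S P n = Inverse ⟪ S ∣ P ⟫ (≡.setoid (Fin n))

_≅_ : Poset a ℓ₁ ℓ₂ → Poset b p q → Set _
P ≅ Q = Σ[ f ∈ (P.Carrier → Q.Carrier) ] IsOrderIsomorphism P._≈_ Q._≈_ P._≤_ Q._≤_ f
  where
  module P = Poset P
  module Q = Poset Q

module _ (P : Poset a ℓ₁ ℓ₂) where

  open Poset P using (Carrier; _≈_) renaming (_≤_ to _≼_)
  open ToStrict _≈_ _≼_ using () renaming (_<_ to _≺_)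

  _⋖_ : Carrier → Carrier → Set _
  x ⋖ y = x ≺ y × ¬ (∃[ z ] (x ≺ z × z ≺ y))

  -- Cov x is the set of y covering x; equality of cardinals of such sets is
  -- the existence of a bijection, so no finiteness is presupposed.
  Cov : Carrier → Pred Carrier _
  Cov x y = x ⋖ y

  Atom : Pred Carrier _
  Atom x = ∃[ ⊥ ] (Minimum _≼_ ⊥ × ⊥ ⋖ x)

  data Chain : Carrier → Carrier → ℕ → Set (a ⊔ ℓ₁ ⊔ ℓ₂) where
    stop : ∀ {x y} → x ≈ y → Chain x y zero
    step : ∀ {x y z k} → x ≺ y → Chain y z k → Chain x z (suc k)

  -- The height of x is the length of a longest chain from the minimum to x.
  HasHeight : Carrier → ℕ → Set _
  HasHeight x k = ∃[ ⊥ ] (Minimum _≼_ ⊥ × Chain ⊥ x k × (∀ n → Chain ⊥ x n → n ≤ k))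

  OfRank : ℕ → Pred Carrier _
  OfRank k x = HasHeight x k

  -- Height is everywhere defined and increases by exactly one along covers.
  IsRanked : Set _
  IsRanked = (∀ x → ∃[ k ] HasHeight x k)
           × (∀ x y k → x ⋖ y → HasHeight x k → HasHeight y (suc k))

  SameCovers : Carrier → Carrier → Set _
  SameCovers y z = Equinumerous (Poset.Eq.setoid P) (Cov y) (Cov z)

  Card : Pred Carrier p → ℕ → Set _
  Card = HasCard (Poset.Eq.setoid P)

IsUniform : Lattice a ℓ₁ ℓ₂ → Set _
IsUniform 𝓛 = IsRanked P × (∀ y z k → HasHeight P y k → HasHeight P z k → SameCovers P y z)
  where P = Lattice.poset 𝓛

module _ (Indep : Pred (Subset m) p) where

  HasRank : Subset m → ℕ → Set _
  HasRank X r = (∃[ I ] (Indep I × I ⊆ X × ∣ I ∣ ≡ r))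
              × (∀ I → Indep I → I ⊆ X → ∣ I ∣ ≤ r)

  cl : Subset m → Pred (Fin m) _
  cl X e = ∃[ r ] (HasRank X r × HasRank (X ∪ ⁅ e ⁆) r)

  Closed : Pred (Subset m) _
  Closed X = cl X ≐ (_∈ₛ X)

  flats : Poset _ _ _
  flats = On.poset (⊆-poset m) (proj₁ {B = Closed})

-- A collection 𝒞 ⊆ 2^U is a predicate on Subset m, so repeated members
-- are not possible.
module _ (𝒞 : Pred (Subset m) p) where

  IsCovering : Set _
  IsCovering = ∀ u → ∃[ C ] (C ∈ 𝒞 × u ∈ₛ C)

  -- The subcollection 𝒞(H) of members of 𝒞 that meet H
  Meeting : Subset m → Pred (Subset m) _
  Meeting H C = C ∈ 𝒞 × Nonempty (C ∩ H)

  PartialTransversal : Pred (Subset m) _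
  PartialTransversal I =
    Σ[ φ ∈ Injection ⟪ ≡.setoid (Fin m) ∣ _∈ₛ I ⟫ ⟪ ≡.setoid (Subset m) ∣ 𝒞 ⟫ ]
      (∀ e → proj₁ e ∈ₛ proj₁ (Injection.to φ e))

  -- The lattice L(𝒞), carried by its inclusion order: meets and joins are
  -- determined by the order, and a poset isomorphism preserves them.
  L : Poset _ _ _
  L = flats PartialTransversal

{-# OPTIONS --safe #-}

-- The hypothesis on 𝒞 makes M(𝒞) simple, so L(𝒞) is a linear space: its atoms are
-- the m points, and any two points lie on a unique line (flat of rank 2).  By Hall's
-- theorem a line with at least three points consists of all points whose blocks are
-- among two fixed members A, B of 𝒞, and one of its points lies in both A and B; this
-- point is on no other line with three points.  Uniformity puts every point on c lines,
-- and counting the points joined to such a special point forces every line to have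
-- either 2 or k = m - c + 1 points.  Hence (s - 2)(s - k) = 0 for every line size s;
-- summing over the lines, with Σ s = mc and Σ s² = m(m - 1) + mc, gives the number
-- of lines.
module Submission where

open import Defs
open import Data.Bool.Base using (Bool; true; false)
import Data.Bool.Properties as Bool
open import Data.Empty as Empty using (⊥-elim)
open import Data.Fin.Base using (Fin; zero; suc)
open import Data.Fin.Properties using (any?; suc-injective; cantor-schröder-bernstein) renaming (_≟_ to _≟ᶠ_)
open import Data.Fin.Subset using (Subset; ∣_∣; ⁅_⁆; _∪_; _⊆_; _⊂_; _∈_; _∉_; inside; outside) renaming (⊥ to ∅)
open import Data.Fin.Subset.Properties
open import Data.Integer.Base as ℤ using (+_)
open import Data.Integer.Properties using (pos-*)
import Data.Integer.Tactic.RingSolver as ℤ-Solver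
open import Data.Nat.Base as ℕ using (ℕ; zero; suc; _+_; _∸_; _≤_; _<_; z≤n; s≤s)
open import Data.Nat.Combinatorics using (_C_; nC1≡n; nCk+nC[k+1]≡[n+1]C[k+1])
open import Data.Nat.Properties
  using ( +-*-commutativeSemiring; +-identityʳ; +-comm; +-suc; *-identityʳ; *-zeroʳ
        ; +-mono-≤; +-monoˡ-≤; +-monoʳ-≤; *-monoʳ-≤; +-cancelʳ-≡; +-cancelʳ-≤; *-cancelˡ-≡
        ; ≤-refl; ≤-reflexive; ≤-trans; ≤-antisym; ≤-pred; _≤?_; <⇒≤; <⇒≱; ≰⇒>
        ; 1+n≰n; m≤m+n; m<n+m; m∸n+n≡m; module ≤-Reasoning)
open import Data.Nat.Tactic.RingSolver using (solve-∀)
open import Data.Product.Base using (Σ-syntax; ∃-syntax; _×_; _,_; proj₁; proj₂)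
open import Data.Rational.Base as ℚ using (_/_; _-_; _*_; toℚᵘ)
open import Data.Rational.Properties using (toℚᵘ-injective; toℚᵘ-fromℚᵘ; toℚᵘ-homo-+; toℚᵘ-homo-*; toℚᵘ-homo‿-)
open import Data.Rational.Unnormalised.Base as ℚᵘ using (ℚᵘ; mkℚᵘ; _≃_; *≡*)
import Data.Rational.Unnormalised.Properties as ℚᵘ
open import Data.Sum.Base using (_⊎_; inj₁; inj₂; [_,_]′; swap)
open import Data.Vec.Base using (_∷_; []; lookup; tabulate; here; there)
open import Data.Vec.Properties using (≡-dec; lookup⇒[]=; []=⇒lookup; lookup∘tabulate)
open import Algebra.Bundles using (CommutativeSemiring)
open import Algebra.Properties.CommutativeMonoid.Sum
  (CommutativeSemiring.+-commutativeMonoid +-*-commutativeSemiring)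
  using (sum; sum-cong-≗; ∑-distrib-+; ∑-comm)
open import Algebra.Properties.Semiring.Sum
  (CommutativeSemiring.semiring +-*-commutativeSemiring)
  using (*-distribˡ-sum; *-distribʳ-sum)
open import Function.Base using (_∘_; id)
open import Function.Bundles using (Inverse; Injection)
import Function.Construct.Composition as Composition
import Function.Construct.Symmetry as Symmetry
open import Function.Definitions using (Injective)
open import Level using (Level)
open import Relation.Binary.Bundles using (Poset)
import Relation.Binary.Construct.NonStrictToStrict as ToStrict
open import Relation.Binary.Definitions using (Minimum)
open import Relation.Binary.Lattice.Bundles using (Lattice)
open import Relation.Binary.Morphism.Structures using (IsOrderIsomorphism)
open import Relation.Binary.PropositionalEquality
open import Relation.Nullary.Decidable using (Dec; yes; no; does; decidable-stable; _×-dec_; ¬?; dec-true)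
open import Relation.Nullary.Negation using (¬_; contradiction)
open import Relation.Unary using (Pred; Decidable; _≐_)

-- Counting the lines of a linear space

χ : Bool → ℕ
χ true  = 1
χ false = 0

sum-const : ∀ n c → sum {n} (λ _ → c) ≡ n ℕ.* c
sum-const zero    c = refl
sum-const (suc n) c = cong (ℕ._+_ c) (sum-const n c)

sum-mono : ∀ {n} {f g : Fin n → ℕ} → (∀ i → f i ≤ g i) → sum f ≤ sum g
sum-mono {zero}  f≤g = z≤n
sum-mono {suc n} f≤g = +-mono-≤ (f≤g zero) (sum-mono (f≤g ∘ suc))

sum-single : ∀ {n} (f : Fin n → ℕ) j → (∀ i → i ≢ j → f i ≡ 0) → sum f ≡ f j
sum-single {suc n} f zero z = trans
  (cong (ℕ._+_ (f zero)) (trans (sum-cong-≗ (λ i → z (suc i) λ ())) (trans (sum-const n 0) (*-zeroʳ n))))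
  (+-identityʳ (f zero))
sum-single f (suc j) z = cong₂ _+_ (z zero λ ()) (sum-single (f ∘ suc) j λ i i≢j → z (suc i) (i≢j ∘ suc-injective))

∣∣≡sum : ∀ {n} (p : Subset n) → ∣ p ∣ ≡ sum (χ ∘ lookup p)
∣∣≡sum []            = refl
∣∣≡sum (inside  ∷ p) = cong suc (∣∣≡sum p)
∣∣≡sum (outside ∷ p) = ∣∣≡sum p

δ : ∀ {n} → Fin n → Fin n → ℕ
δ i j with i ≟ᶠ j
... | yes _ = 1
... | no  _ = 0

δ-diag : ∀ {n} (i : Fin n) → δ i i ≡ 1
δ-diag i with i ≟ᶠ i
... | yes _  = refl
... | no i≢i = ⊥-elim (i≢i refl)

δ-off : ∀ {n} {i j : Fin n} → i ≢ j → δ i j ≡ 0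
δ-off {i = i} {j} i≢j with i ≟ᶠ j
... | yes i≡j = ⊥-elim (i≢j i≡j)
... | no _    = refl

sum-δ : ∀ {n} (f : Fin n → ℕ) j → sum (λ i → δ i j ℕ.* f i) ≡ f j
sum-δ f j = trans (sum-single (λ i → δ i j ℕ.* f i) j λ i i≢j → cong (ℕ._* f i) (δ-off i≢j))
                  (trans (cong (ℕ._* f j) (δ-diag j)) (+-identityʳ (f j)))

-- The pairs `(i , j)` with `h j ≡ i` are counted in both orders: each `j` gives one pair, each `i`
-- gives `χ (b i)`.
count-image : ∀ {n c} (b : Fin n → Bool) (h : Fin c → Fin n) → Injective _≡_ _≡_ h →
  (∀ j → b (h j) ≡ true) → (∀ i → b i ≡ true → ∃[ j ] h j ≡ i) → sum (χ ∘ b) ≡ c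
count-image {n} {c} b h h-inj h∈b onto = begin
  sum (χ ∘ b)                       ≡⟨ sum-cong-≗ fibre ⟨
  sum (λ i → sum (λ j → δ i (h j))) ≡⟨ ∑-comm (λ i j → δ i (h j)) ⟩
  sum (λ j → sum (λ i → δ i (h j))) ≡⟨ sum-cong-≗ (λ j → trans (sum-single (λ i → δ i (h j)) (h j) (λ i → δ-off)) (δ-diag (h j))) ⟩
  sum {c} (λ j → 1)                 ≡⟨ trans (sum-const c 1) (*-identityʳ c) ⟩
  c                                     ∎
  where
  open ≡-Reasoning
  fibre : ∀ i → sum (λ j → δ i (h j)) ≡ χ (b i)
  fibre i with b i in eq
  ... | true with j , refl ← onto i eq =
    trans (sum-single (λ k → δ (h j) (h k)) j λ k k≢j → δ-off (k≢j ∘ sym ∘ h-inj)) (δ-diag (h j))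
  ... | false = trans
    (sum-cong-≗ {c} λ j → δ-off λ { refl → contradiction (trans (sym eq) (h∈b j)) λ () })
    (trans (sum-const c 0) (*-zeroʳ c))

-- `joins` is the axiom of a linear space and `degree` is what uniformity provides; `special` is the
-- only trace left of the transversal structure.
module LinearSpace {m n c : ℕ} (S : Fin n → Subset m)
  (joins   : ∀ u v → u ≢ v → ∃[ i ] (u ∈ S i × v ∈ S i × (∀ j → u ∈ S j → v ∈ S j → j ≡ i)))
  (degree  : ∀ u → sum (λ i → χ (lookup (S i) u)) ≡ c)
  (2≤∣S∣   : ∀ i → 2 ≤ ∣ S i ∣)
  (special : ∀ i → 3 ≤ ∣ S i ∣ → ∃[ u ] (u ∈ S i × (∀ j → u ∈ S j → 3 ≤ ∣ S j ∣ → j ≡ i)))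
  where

  x : Fin n → Fin m → ℕ
  x i u = χ (lookup (S i) u)

  s : Fin n → ℕ
  s i = ∣ S i ∣

  x-∈ : ∀ {i u} → u ∈ S i → x i u ≡ 1
  x-∈ u∈ = cong χ ([]=⇒lookup u∈)

  ∈-x : ∀ {i u} → lookup (S i) u ≡ true → u ∈ S i
  ∈-x {i} {u} = lookup⇒[]= u (S i)

  x-idem : ∀ i u → x i u ℕ.* x i u ≡ x i u
  x-idem i u with lookup (S i) u
  ... | true  = refl
  ... | false = refl

  -- The δ term absorbs the diagonal u = v without subtraction.
  joint-degree : ∀ u v → sum (λ i → x i u ℕ.* x i v) + δ v u ≡ 1 + δ v u ℕ.* c
  joint-degree u v with v ≟ᶠ u
  ... | yes refl = let open ≡-Reasoning in begin
    sum (λ i → x i u ℕ.* x i u) + 1 ≡⟨ cong (_+ 1) (trans (sum-cong-≗ λ i → x-idem i u) (degree u)) ⟩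
    c + 1                           ≡⟨ +-comm c 1 ⟩
    1 + c                           ≡⟨ cong suc (+-identityʳ c) ⟨
    1 + 1 ℕ.* c                     ∎
  ... | no v≢u with i , u∈ , v∈ , uniq ← joins u v (v≢u ∘ sym) =
    cong (_+ 0) (trans (sum-single (λ i → x i u ℕ.* x i v) i off) (cong₂ ℕ._*_ (x-∈ u∈) (x-∈ v∈)))
    where
    off : ∀ j → j ≢ i → x j u ℕ.* x j v ≡ 0
    off j j≢i with lookup (S j) u in eq | lookup (S j) v in eq′
    ... | false | _     = refl
    ... | true  | false = refl
    ... | true  | true  = ⊥-elim (j≢i (uniq j (∈-x eq) (∈-x eq′)))

  -- Among the pairs of a line through `u` and a point `v` on it, each `v` other than `u` occurs
  -- once and `u` itself occurs `c` times, so the sizes add up to `m - 1 + c`.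
  sizes-through : ∀ u → sum (λ i → x i u ℕ.* s i) + 1 ≡ m + c
  sizes-through u = let open ≡-Reasoning in begin
    sum (λ i → x i u ℕ.* s i) + 1
      ≡⟨ cong (_+ 1) (sum-cong-≗ λ i → trans (cong (x i u ℕ.*_) (∣∣≡sum (S i))) (*-distribˡ-sum (x i u) (x i))) ⟩
    sum (λ i → sum (λ v → x i u ℕ.* x i v)) + 1
      ≡⟨ cong₂ _+_ (∑-comm (λ i v → x i u ℕ.* x i v)) (sym (trans (sum-single (λ v → δ v u) u λ _ → δ-off) (δ-diag u))) ⟩
    sum (λ v → sum (λ i → x i u ℕ.* x i v)) + sum (λ v → δ v u)
      ≡⟨ ∑-distrib-+ _ (λ v → δ v u) ⟨
    sum (λ v → sum (λ i → x i u ℕ.* x i v) + δ v u)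
      ≡⟨ sum-cong-≗ (joint-degree u) ⟩
    sum (λ v → 1 + δ v u ℕ.* c)
      ≡⟨ ∑-distrib-+ {m} (λ _ → 1) (λ v → δ v u ℕ.* c) ⟩
    sum {m} (λ _ → 1) + sum (λ v → δ v u ℕ.* c)
      ≡⟨ cong₂ _+_ (trans (sum-const m 1) (*-identityʳ m)) (sum-δ (λ _ → c) u) ⟩
    m + c ∎

  -- The `c` lines through `u` have at least two points each, so `2c ≤ m + c - 1`. Hence `m ∸ c` is
  -- a true difference.
  degree< : Fin m → c < m
  degree< u = +-cancelʳ-≤ c (suc c) m (let open ≤-Reasoning in begin
    suc c + c                     ≡⟨ double c ⟩
    c ℕ.* 2 + 1                   ≡⟨ cong (λ d → d ℕ.* 2 + 1) (degree u) ⟨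
    sum (λ i → x i u) ℕ.* 2 + 1   ≡⟨ cong (_+ 1) (*-distribʳ-sum 2 (λ i → x i u)) ⟩
    sum (λ i → x i u ℕ.* 2) + 1   ≤⟨ +-monoˡ-≤ 1 (sum-mono λ i → *-monoʳ-≤ (x i u) (2≤∣S∣ i)) ⟩
    sum (λ i → x i u ℕ.* s i) + 1 ≡⟨ sizes-through u ⟩
    m + c                         ∎)
    where
    double : ∀ c → suc c + c ≡ c ℕ.* 2 + 1
    double = solve-∀

  -- All lines through the special point of a line ℓ other than ℓ itself have two points.
  long-size : ∀ i → 3 ≤ s i → s i + c ≡ suc m
  long-size i 3≤s with u , u∈ , uniq ← special i 3≤s = +-cancelʳ-≡ (c + 1) (s i + c) (suc m) (begin
    s i + c + (c + 1)
      ≡⟨ rearrange (s i) c ⟩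
    c ℕ.* 2 + s i + 1
      ≡⟨ cong₂ (λ a b → a + b + 1) (trans (cong (ℕ._* 2) (sym (degree u))) (*-distribʳ-sum 2 λ j → x j u)) (sym (sum-δ s i)) ⟩
    sum (λ j → x j u ℕ.* 2) + sum (λ j → δ j i ℕ.* s j) + 1
      ≡⟨ cong (_+ 1) (∑-distrib-+ (λ j → x j u ℕ.* 2) (λ j → δ j i ℕ.* s j)) ⟨
    sum (λ j → x j u ℕ.* 2 + δ j i ℕ.* s j) + 1
      ≡⟨ cong (_+ 1) (sum-cong-≗ split) ⟩
    sum (λ j → x j u ℕ.* s j + δ j i ℕ.* 2) + 1
      ≡⟨ cong (_+ 1) (∑-distrib-+ (λ j → x j u ℕ.* s j) (λ j → δ j i ℕ.* 2)) ⟩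
    sum (λ j → x j u ℕ.* s j) + sum (λ j → δ j i ℕ.* 2) + 1
      ≡⟨ cong (λ a → sum (λ j → x j u ℕ.* s j) + a + 1) (sum-δ (λ _ → 2) i) ⟩
    sum (λ j → x j u ℕ.* s j) + 2 + 1
      ≡⟨ shift (sum (λ j → x j u ℕ.* s j)) ⟩
    sum (λ j → x j u ℕ.* s j) + 1 + 2
      ≡⟨ cong (_+ 2) (sizes-through u) ⟩
    m + c + 2
      ≡⟨ rearrange′ m c ⟩
    suc m + (c + 1) ∎)
    where
    open ≡-Reasoning
    rearrange : ∀ s c → s + c + (c + 1) ≡ c ℕ.* 2 + s + 1
    rearrange = solve-∀
    rearrange′ : ∀ m c → m + c + 2 ≡ suc m + (c + 1)
    rearrange′ = solve-∀
    shift : ∀ t → t + 2 + 1 ≡ t + 1 + 2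
    shift = solve-∀
    -- Away from `i` both sides agree because the line misses `u` or has two points; at `i` the δ
    -- terms exchange `s i` and 2.
    split : ∀ j → x j u ℕ.* 2 + δ j i ℕ.* s j ≡ x j u ℕ.* s j + δ j i ℕ.* 2
    split j with j ≟ᶠ i
    ... | yes refl = trans (cong (λ a → a ℕ.* 2 + 1 ℕ.* s i) (x-∈ u∈))
      (trans (+-comm 2 (1 ℕ.* s i)) (cong (λ a → a ℕ.* s i + 2) (sym (x-∈ u∈))))
    ... | no j≢i with lookup (S j) u in eq
    ...   | false = refl
    ...   | true with 3 ≤? s j
    ...     | yes 3≤ = contradiction (uniq j (∈-x eq) 3≤) j≢i
    ...     | no  3≰ = cong (λ a → 1 ℕ.* a + 0) (≤-antisym (2≤∣S∣ j) (≤-pred (≰⇒> 3≰)))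

  -- The common size of the long lines, and the denominator of the final formula.
  k : ℕ
  k = suc (m ∸ c)

  -- This is `(s - 2)(s - k) = 0` with the negative terms moved across. A point is taken as argument
  -- because `c < m` needs one.
  size-quadratic : Fin m → ∀ i → s i ℕ.* s i + 2 ℕ.* k ≡ (2 + k) ℕ.* s i
  size-quadratic u i with 3 ≤? s i
  ... | yes 3≤ = subst (λ t → t ℕ.* t + 2 ℕ.* k ≡ (2 + k) ℕ.* t) (sym s≡k) (factor k)
    where
    factor : ∀ k → k ℕ.* k + 2 ℕ.* k ≡ (2 + k) ℕ.* k
    factor = solve-∀
    s≡k : s i ≡ k
    s≡k = +-cancelʳ-≡ c (s i) k (trans (long-size i 3≤) (cong suc (sym (m∸n+n≡m (<⇒≤ (degree< u))))))
  ... | no 3≰ = subst (λ t → t ℕ.* t + 2 ℕ.* k ≡ (2 + k) ℕ.* t) (≤-antisym (2≤∣S∣ i) (≤-pred (≰⇒> 3≰))) (factor k)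
    where
    factor : ∀ k → 2 ℕ.* 2 + 2 ℕ.* k ≡ (2 + k) ℕ.* 2
    factor = solve-∀

  sum-sizes : sum s ≡ m ℕ.* c
  sum-sizes = begin
    sum s                         ≡⟨ sum-cong-≗ (λ i → ∣∣≡sum (S i)) ⟩
    sum (λ i → sum (λ u → x i u)) ≡⟨ ∑-comm x ⟩
    sum (λ u → sum (λ i → x i u)) ≡⟨ sum-cong-≗ degree ⟩
    sum {m} (λ _ → c)             ≡⟨ sum-const m c ⟩
    m ℕ.* c                       ∎
    where open ≡-Reasoning

  -- Summing `sizes-through` over all points counts line `i` with weight `s i` once for each of its
  -- `s i` points.
  sum-squares : sum (λ i → s i ℕ.* s i) + m ≡ m ℕ.* (m + c)
  sum-squares = begin
    sum (λ i → s i ℕ.* s i) + m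
      ≡⟨ cong (_+ m) (sum-cong-≗ λ i → trans (cong (ℕ._* s i) (∣∣≡sum (S i))) (*-distribʳ-sum (s i) (x i))) ⟩
    sum (λ i → sum (λ u → x i u ℕ.* s i)) + m
      ≡⟨ cong₂ _+_ (∑-comm (λ i u → x i u ℕ.* s i)) (sym (trans (sum-const m 1) (*-identityʳ m))) ⟩
    sum (λ u → sum (λ i → x i u ℕ.* s i)) + sum {m} (λ _ → 1)
      ≡⟨ ∑-distrib-+ {m} (λ u → sum (λ i → x i u ℕ.* s i)) (λ _ → 1) ⟨
    sum (λ u → sum (λ i → x i u ℕ.* s i) + 1)
      ≡⟨ sum-cong-≗ sizes-through ⟩
    sum {m} (λ _ → m + c)
      ≡⟨ sum-const m (m + c) ⟩
    m ℕ.* (m + c) ∎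
    where open ≡-Reasoning

  sum-quadratic : Fin m → m ℕ.* (m + c) + n ℕ.* (2 ℕ.* k) ≡ (2 + k) ℕ.* (m ℕ.* c) + m
  sum-quadratic u = begin
    m ℕ.* (m + c) + n ℕ.* (2 ℕ.* k)
      ≡⟨ cong₂ _+_ (sym sum-squares) (sym (sum-const n (2 ℕ.* k))) ⟩
    sum (λ i → s i ℕ.* s i) + m + sum {n} (λ _ → 2 ℕ.* k)
      ≡⟨ +-right-comm (sum λ i → s i ℕ.* s i) m (sum {n} λ _ → 2 ℕ.* k) ⟩
    sum (λ i → s i ℕ.* s i) + sum {n} (λ _ → 2 ℕ.* k) + m
      ≡⟨ cong (_+ m) (∑-distrib-+ (λ i → s i ℕ.* s i) (λ _ → 2 ℕ.* k)) ⟨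
    sum (λ i → s i ℕ.* s i + 2 ℕ.* k) + m
      ≡⟨ cong (_+ m) (sum-cong-≗ (size-quadratic u)) ⟩
    sum (λ i → (2 + k) ℕ.* s i) + m
      ≡⟨ cong (_+ m) (*-distribˡ-sum (2 + k) s) ⟨
    (2 + k) ℕ.* sum s + m
      ≡⟨ cong (λ t → (2 + k) ℕ.* t + m) sum-sizes ⟩
    (2 + k) ℕ.* (m ℕ.* c) + m ∎
    where
    open ≡-Reasoning
    +-right-comm : ∀ a b c → a + b + c ≡ a + c + b
    +-right-comm = solve-∀

  -- Eliminating `c = m + 1 - k` from `sum-quadratic` leaves a relation between `n`, `k` and `m`
  -- alone.
  line-count : Fin m → 2 ℕ.* k ℕ.* n + k ℕ.* k ℕ.* m ≡ k ℕ.* (m ℕ.* m) + 2 ℕ.* m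
  line-count u = +-cancelʳ-≡ (m ℕ.* (m + c)) _ _ (begin
    2 ℕ.* k ℕ.* n + k ℕ.* k ℕ.* m + m ℕ.* (m + c)
      ≡⟨ collect k n m (m ℕ.* (m + c)) ⟩
    m ℕ.* (m + c) + n ℕ.* (2 ℕ.* k) + k ℕ.* k ℕ.* m
      ≡⟨ cong (_+ k ℕ.* k ℕ.* m) (sum-quadratic u) ⟩
    (2 + k) ℕ.* (m ℕ.* c) + m + k ℕ.* k ℕ.* m
      -- With `m` written as `d + c` and `k` as `suc d` no subtraction remains, and the ring solver
      -- applies.
      ≡⟨ subst (λ t → (3 + d) ℕ.* (t ℕ.* c) + t + k ℕ.* k ℕ.* t ≡ k ℕ.* (t ℕ.* t) + 2 ℕ.* t + t ℕ.* (t + c)) m∸c+c (expand d c) ⟩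
    k ℕ.* (m ℕ.* m) + 2 ℕ.* m + m ℕ.* (m + c) ∎)
    where
    open ≡-Reasoning
    d = m ∸ c
    m∸c+c : d + c ≡ m
    m∸c+c = m∸n+n≡m (<⇒≤ (degree< u))
    collect : ∀ k n m t → 2 ℕ.* k ℕ.* n + k ℕ.* k ℕ.* m + t ≡ t + n ℕ.* (2 ℕ.* k) + k ℕ.* k ℕ.* m
    collect = solve-∀
    expand : ∀ d c → (3 + d) ℕ.* ((d + c) ℕ.* c) + (d + c) + suc d ℕ.* suc d ℕ.* (d + c)
           ≡ suc d ℕ.* ((d + c) ℕ.* (d + c)) + 2 ℕ.* (d + c) + (d + c) ℕ.* (d + c + c)
    expand = solve-∀

-- Arithmetic of the resulting formula

2*[nC2]+n≡n*n : ∀ n → 2 ℕ.* (n C 2) + n ≡ n ℕ.* n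
2*[nC2]+n≡n*n zero    = refl
2*[nC2]+n≡n*n (suc n) = begin
  2 ℕ.* (suc n C 2) + suc n         ≡⟨ cong (λ t → 2 ℕ.* t + suc n) (nCk+nC[k+1]≡[n+1]C[k+1] n 1) ⟨
  2 ℕ.* (n C 1 + n C 2) + suc n     ≡⟨ cong (λ t → 2 ℕ.* (t + n C 2) + suc n) (nC1≡n n) ⟩
  2 ℕ.* (n + n C 2) + suc n         ≡⟨ regroup n (n C 2) ⟩
  2 ℕ.* (n C 2) + n + (2 ℕ.* n + 1) ≡⟨ cong (_+ (2 ℕ.* n + 1)) (2*[nC2]+n≡n*n n) ⟩
  n ℕ.* n + (2 ℕ.* n + 1)           ≡⟨ square n ⟩
  suc n ℕ.* suc n                   ∎
  where
  open ≡-Reasoning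
  regroup : ∀ n t → 2 ℕ.* (n + t) + suc n ≡ 2 ℕ.* t + n + (2 ℕ.* n + 1)
  regroup = solve-∀
  square : ∀ n → n ℕ.* n + (2 ℕ.* n + 1) ≡ suc n ℕ.* suc n
  square = solve-∀

-- Doubling and adding `k * a` completes each binomial coefficient to a square, which turns the
-- claim into the hypothesis.
binomial-form : ∀ n a k → 2 ℕ.* k ℕ.* n + k ℕ.* k ℕ.* a ≡ k ℕ.* (a ℕ.* a) + 2 ℕ.* a →
  n ℕ.* k + (k C 2) ℕ.* a ≡ (a C 2) ℕ.* k + a
binomial-form n a k eq = *-cancelˡ-≡ _ _ 2 (+-cancelʳ-≡ (k ℕ.* a) _ _ (begin
  2 ℕ.* (n ℕ.* k + (k C 2) ℕ.* a) + k ℕ.* a ≡⟨ left n k (k C 2) a ⟩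
  2 ℕ.* k ℕ.* n + (2 ℕ.* (k C 2) + k) ℕ.* a ≡⟨ cong (λ t → 2 ℕ.* k ℕ.* n + t ℕ.* a) (2*[nC2]+n≡n*n k) ⟩
  2 ℕ.* k ℕ.* n + k ℕ.* k ℕ.* a             ≡⟨ eq ⟩
  k ℕ.* (a ℕ.* a) + 2 ℕ.* a                 ≡⟨ cong (λ t → k ℕ.* t + 2 ℕ.* a) (2*[nC2]+n≡n*n a) ⟨
  k ℕ.* (2 ℕ.* (a C 2) + a) + 2 ℕ.* a       ≡⟨ right k (a C 2) a ⟩
  2 ℕ.* ((a C 2) ℕ.* k + a) + k ℕ.* a       ∎))
  where
  open ≡-Reasoning
  left : ∀ n k q a → 2 ℕ.* (n ℕ.* k + q ℕ.* a) + k ℕ.* a ≡ 2 ℕ.* k ℕ.* n + (2 ℕ.* q + k) ℕ.* a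
  left = solve-∀
  right : ∀ k p a → k ℕ.* (2 ℕ.* p + a) + 2 ℕ.* a ≡ 2 ℕ.* (p ℕ.* k + a) + k ℕ.* a
  right = solve-∀

-- Equality of unnormalised rationals is cross-multiplied equality of integers, so both sides are
-- moved there and the division disappears.
rational-form : ∀ n p q a d → n ℕ.* suc d + q ℕ.* a ≡ p ℕ.* suc d + a →
  ι n ≡ ι p - (ι q - ι 1) * (+ a / suc d)
rational-form n p q a d eq = toℚᵘ-injective (begin
  toℚᵘ (ι n)                                     ≈⟨ toℚᵘ-fromℚᵘ (int n) ⟩
  int n                                          ≈⟨ *≡* (crossed (+ n) (+ p) (+ q) (+ a) (cong +_ (+-identityʳ (suc d))) (cong +_ (trans (+-identityʳ (suc d + 0)) (+-identityʳ (suc d)))) ℤeq) ⟩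
  int p ℚᵘ.- (int q ℚᵘ.- int 1) ℚᵘ.* mkℚᵘ (+ a) d
    ≈⟨ -ᵘ-cong (toℚᵘ-fromℚᵘ (int p)) (ℚᵘ.*-cong (-ᵘ-cong (toℚᵘ-fromℚᵘ (int q)) (toℚᵘ-fromℚᵘ (int 1))) (toℚᵘ-fromℚᵘ (mkℚᵘ (+ a) d))) ⟨
  toℚᵘ (ι p) ℚᵘ.- (toℚᵘ (ι q) ℚᵘ.- toℚᵘ (ι 1)) ℚᵘ.* toℚᵘ (+ a / suc d)
    ≈⟨ -ᵘ-cong (ℚᵘ.≃-refl {toℚᵘ (ι p)}) (ℚᵘ.*-congʳ (toℚᵘ-homo-- (ι q) (ι 1))) ⟨
  toℚᵘ (ι p) ℚᵘ.- toℚᵘ (ι q - ι 1) ℚᵘ.* toℚᵘ (+ a / suc d)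
    ≈⟨ -ᵘ-cong (ℚᵘ.≃-refl {toℚᵘ (ι p)}) (toℚᵘ-homo-* (ι q - ι 1) (+ a / suc d)) ⟨
  toℚᵘ (ι p) ℚᵘ.- toℚᵘ ((ι q - ι 1) * (+ a / suc d))
    ≈⟨ toℚᵘ-homo-- (ι p) ((ι q - ι 1) * (+ a / suc d)) ⟨
  toℚᵘ (ι p - (ι q - ι 1) * (+ a / suc d))      ∎)
  where
  open ℚᵘ.≃-Reasoning
  int : ℕ → ℚᵘ
  int t = mkℚᵘ (+ t) 0
  -ᵘ-cong : ∀ {x x′ y y′} → x ≃ x′ → y ≃ y′ → x ℚᵘ.- y ≃ x′ ℚᵘ.- y′
  -ᵘ-cong x≃ y≃ = ℚᵘ.+-cong x≃ (ℚᵘ.-‿cong y≃)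
  toℚᵘ-homo-- : ∀ x y → toℚᵘ (x - y) ≃ toℚᵘ x ℚᵘ.- toℚᵘ y
  toℚᵘ-homo-- x y = ℚᵘ.≃-trans (toℚᵘ-homo-+ x (ℚ.- y)) (ℚᵘ.+-congʳ (toℚᵘ x) (toℚᵘ-homo‿- y))
  ℤeq : + n ℤ.* + suc d ℤ.+ + q ℤ.* + a ≡ + p ℤ.* + suc d ℤ.+ + a
  ℤeq = trans (cong₂ ℤ._+_ (sym (pos-* n (suc d))) (sym (pos-* q a)))
        (trans (cong +_ eq) (cong (ℤ._+ + a) (pos-* p (suc d))))
  -- k₁ and k₂ are the denominators of the inner and of the whole right-hand side,
  -- which Agda leaves as suc d + 0 and suc d + 0 + 0.
  crossed : ∀ n p q a {k k₁ k₂} → k₁ ≡ k → k₂ ≡ k → n ℤ.* k ℤ.+ q ℤ.* a ≡ p ℤ.* k ℤ.+ a →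
    n ℤ.* k₂ ≡ (p ℤ.* k₁ ℤ.+ (ℤ.- ((q ℤ.* + 1 ℤ.+ (ℤ.- + 1) ℤ.* + 1) ℤ.* a)) ℤ.* + 1) ℤ.* + 1
  crossed n p q a {k} refl refl eq = ≡.begin
    n ℤ.* k                               ≡.≡⟨ add (n ℤ.* k) (q ℤ.* a) ⟩
    n ℤ.* k ℤ.+ q ℤ.* a ℤ.- q ℤ.* a       ≡.≡⟨ cong (ℤ._- q ℤ.* a) eq ⟩
    p ℤ.* k ℤ.+ a ℤ.- q ℤ.* a             ≡.≡⟨ expand p q a k ⟩
    _                                     ≡.∎
    where
    module ≡ = ≡-Reasoning
    add : ∀ x y → x ≡ x ℤ.+ y ℤ.- y
    add = ℤ-Solver.solve-∀
    expand : ∀ p q a k → p ℤ.* k ℤ.+ a ℤ.- q ℤ.* a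
      ≡ (p ℤ.* k ℤ.+ (ℤ.- ((q ℤ.* + 1 ℤ.+ (ℤ.- + 1) ℤ.* + 1) ℤ.* a)) ℤ.* + 1) ℤ.* + 1
    expand = ℤ-Solver.solve-∀

-- Transport along order isomorphisms

private
  variable
    a b p q r s : Level

module _ (P : Poset a p q) where
  open Poset P using (_≈_; module Eq; ≤-respˡ-≈)
    renaming (_≤_ to _≼_; trans to ≼-trans; reflexive to ≼-reflexive; antisym to ≼-antisym)
  open ToStrict _≈_ _≼_ using () renaming (_<_ to _≺_)

  -- `L 𝒞` is given as a poset. Its meets are borrowed from `𝓛` through the isomorphism, which
  -- spares a proof that flats are closed under intersection.
  HasMeets : Set _
  HasMeets = ∀ x y → ∃[ z ] (z ≼ x × z ≼ y × (∀ w → w ≼ x → w ≼ y → w ≼ z))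

  chain⇒≤ : ∀ {x y n} → Chain P x y n → x ≼ y
  chain⇒≤ (stop x≈y)     = ≼-reflexive x≈y
  chain⇒≤ (step x≺y ch) = ≼-trans (proj₁ x≺y) (chain⇒≤ ch)

  chain-resp : ∀ {x x′ y y′ n} → x ≈ x′ → y ≈ y′ → Chain P x y n → Chain P x′ y′ n
  chain-resp x≈x′ y≈y′ (stop x≈y) = stop (Eq.trans (Eq.sym x≈x′) (Eq.trans x≈y y≈y′))
  chain-resp x≈x′ y≈y′ (step x≺z ch) =
    step (ToStrict.<-respˡ-≈ _≈_ _≼_ Eq.trans ≤-respˡ-≈ x≈x′ x≺z) (chain-resp Eq.refl y≈y′ ch)

  minimum-height : ∀ {x} → Minimum _≼_ x → HasHeight P x 0
  minimum-height {x} min = x , min , stop Eq.refl , bound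
    where
    bound : ∀ n → Chain P x x n → n ≤ 0
    bound zero    _                        = z≤n
    bound (suc n) (step (x≤y , x≉y) y⋯x) = ⊥-elim (x≉y (≼-antisym x≤y (chain⇒≤ y⋯x)))

module _ {P : Poset a p q} {Q : Poset b r s} (P≅Q : P ≅ Q) where
  private
    module P = Poset P
    module Q = Poset Q
    f = proj₁ P≅Q
  open IsOrderIsomorphism (proj₂ P≅Q) using (mono; injective; cancel; surjective) renaming (cong to f-cong)
  open ToStrict P._≈_ P._≤_ using () renaming (_<_ to _≺₁_)
  open ToStrict Q._≈_ Q._≤_ using () renaming (_<_ to _≺₂_)

  private
    g : Q.Carrier → P.Carrier
    g y = proj₁ (surjective y)

    f∘g : ∀ y → f (g y) Q.≈ y
    f∘g y = proj₂ (surjective y) P.Eq.refl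

  <-mono : ∀ {x y} → x ≺₁ y → f x ≺₂ f y
  <-mono (x≤y , x≉y) = mono x≤y , x≉y ∘ injective

  <-cancel : ∀ {x y} → f x ≺₂ f y → x ≺₁ y
  <-cancel (fx≤fy , fx≉fy) = cancel fx≤fy , fx≉fy ∘ f-cong

  private
    <-respˡ : ∀ {x x′ y} → x Q.≈ x′ → x ≺₂ y → x′ ≺₂ y
    <-respˡ = ToStrict.<-respˡ-≈ Q._≈_ Q._≤_ Q.Eq.trans Q.≤-respˡ-≈

    <-respʳ : ∀ {x y y′} → y Q.≈ y′ → x ≺₂ y → x ≺₂ y′
    <-respʳ = ToStrict.<-respʳ-≈ Q._≈_ Q._≤_ Q.Eq.sym Q.Eq.trans Q.≤-respʳ-≈

  cover-mono : ∀ {x y} → Cov P x y → Cov Q (f x) (f y)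
  cover-mono (x≺y , none) = <-mono x≺y , λ (z , fx≺z , z≺fy) →
    none (g z , <-cancel (<-respʳ (Q.Eq.sym (f∘g z)) fx≺z) , <-cancel (<-respˡ (Q.Eq.sym (f∘g z)) z≺fy))

  cover-reflect : ∀ {x y} → Cov Q (f x) y → Cov P x (g y)
  cover-reflect {y = y} (fx≺y , none) = <-cancel (<-respʳ (Q.Eq.sym (f∘g y)) fx≺y) ,
    λ (z , x≺z , z≺gy) → none (f z , <-mono x≺z , <-respʳ (f∘g y) (<-mono z≺gy))

  chain-mono : ∀ {x y n} → Chain P x y n → Chain Q (f x) (f y) n
  chain-mono (stop x≈y)     = stop (f-cong x≈y)
  chain-mono (step x≺y ch) = step (<-mono x≺y) (chain-mono ch)

  chain-cancel : ∀ {x y n} → Chain Q (f x) (f y) n → Chain P x y n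
  chain-cancel (stop fx≈fy) = stop (injective fx≈fy)
  chain-cancel (step {y = y} fx≺y ch) =
    step (<-cancel (<-respʳ (Q.Eq.sym (f∘g y)) fx≺y)) (chain-cancel (chain-resp Q (Q.Eq.sym (f∘g y)) Q.Eq.refl ch))

  height-mono : ∀ {x k} → HasHeight P x k → HasHeight Q (f x) k
  height-mono (⊥ , min , ch , bound) =
    f ⊥ , (λ y → Q.≤-respʳ-≈ (f∘g y) (mono (min (g y)))) , chain-mono ch , λ n → bound n ∘ chain-cancel

  -- Membership proofs do not enter the comparison of elements, so carrying `A` along `f` and `B`
  -- along `g` already gives a bijection.
  restrict : ∀ {ℓ ℓ′} {A : Pred P.Carrier ℓ} {B : Pred Q.Carrier ℓ′} →
    (∀ {x} → A x → B (f x)) → (∀ {y} → B y → A (g y)) →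
    Inverse ⟪ P.Eq.setoid ∣ A ⟫ ⟪ Q.Eq.setoid ∣ B ⟫
  restrict A⇒B B⇒A = record
    { to        = λ (x , a) → f x , A⇒B a
    ; from      = λ (y , b) → g y , B⇒A b
    ; to-cong   = f-cong
    ; from-cong = λ {x} {y} x≈y → injective (Q.Eq.trans (f∘g (proj₁ x)) (Q.Eq.trans x≈y (Q.Eq.sym (f∘g (proj₁ y)))))
    ; inverse   = (λ {y} x≈gy → Q.Eq.trans (f-cong x≈gy) (f∘g (proj₁ y)))
                , (λ {x} {y} y≈fx → injective (Q.Eq.trans (f∘g (proj₁ y)) y≈fx))
    }

  ranks-↔ : ∀ k → Inverse ⟪ P.Eq.setoid ∣ OfRank P k ⟫ ⟪ Q.Eq.setoid ∣ OfRank Q k ⟫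
  ranks-↔ k = restrict height-mono height-reflect
    where
    height-reflect : ∀ {y} → HasHeight Q y k → HasHeight P (g y) k
    height-reflect (⊥ , min , ch , bound) =
      g ⊥ , (λ x → cancel (Q.≤-respˡ-≈ (Q.Eq.sym (f∘g ⊥)) (min (f x)))) ,
      chain-cancel (chain-resp Q (Q.Eq.sym (f∘g ⊥)) (Q.Eq.sym (f∘g _)) ch) ,
      λ n → bound n ∘ chain-resp Q (f∘g ⊥) (f∘g _) ∘ chain-mono

  covers-↔ : ∀ x → Inverse ⟪ P.Eq.setoid ∣ Cov P x ⟫ ⟪ Q.Eq.setoid ∣ Cov Q (f x) ⟫
  covers-↔ x = restrict cover-mono cover-reflect

-- The transversal matroid of 𝒞

∣⁅x⁆∪p∣ : ∀ {n} {x : Fin n} {p : Subset n} → x ∉ p → ∣ ⁅ x ⁆ ∪ p ∣ ≡ suc ∣ p ∣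
∣⁅x⁆∪p∣ {x = zero}  {inside  ∷ p} x∉p = contradiction here x∉p
∣⁅x⁆∪p∣ {x = zero}  {outside ∷ p} x∉p = cong (suc ∘ ∣_∣) (∪-identityˡ p)
∣⁅x⁆∪p∣ {x = suc x} {inside  ∷ p} x∉p = cong suc (∣⁅x⁆∪p∣ (x∉p ∘ there))
∣⁅x⁆∪p∣ {x = suc x} {outside ∷ p} x∉p = ∣⁅x⁆∪p∣ (x∉p ∘ there)

-- Returning the remainder `q`, which omits `x`, lets repeated picks produce distinct elements.
pick : ∀ {n k} {p : Subset n} → suc k ≤ ∣ p ∣ → ∃[ x ] ∃[ q ] (x ∈ p × q ⊆ p × x ∉ q × k ≤ ∣ q ∣)
pick {p = inside  ∷ p} (s≤s k≤) = zero , outside ∷ p , here , out⊆ id , (λ ()) , k≤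
pick {p = outside ∷ p} k<
  with x , q , x∈p , q⊆p , x∉q , k≤ ← pick {p = p} k<
  = suc x , outside ∷ q , there x∈p , out⊆ q⊆p , x∉q ∘ drop-there , k≤

pick₂ : ∀ {n} {p : Subset n} → 2 ≤ ∣ p ∣ → ∃[ x ] ∃[ y ] (x ≢ y × x ∈ p × y ∈ p)
pick₂ 2≤ with x , q , x∈p , q⊆p , x∉q , 1≤ ← pick 2≤
         with y , _ , y∈q , _ ← pick 1≤
         = x , y , (λ { refl → x∉q y∈q }) , x∈p , q⊆p y∈q

pick₃ : ∀ {n} {p : Subset n} → 3 ≤ ∣ p ∣ →
  ∃[ x ] ∃[ y ] ∃[ z ] (x ≢ y × x ≢ z × y ≢ z × x ∈ p × y ∈ p × z ∈ p)
pick₃ 3≤ with x , q , x∈p , q⊆p , x∉q , 2≤ ← pick 3≤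
         with y , z , y≢z , y∈q , z∈q ← pick₂ 2≤
         = x , y , z , (λ { refl → x∉q y∈q }) , (λ { refl → x∉q z∈q }) , y≢z , x∈p , q⊆p y∈q , q⊆p z∈q

⊆∧≢⇒⊂ : ∀ {n} {p q : Subset n} → p ⊆ q → p ≢ q → p ⊂ q
⊆∧≢⇒⊂ {p = p} {q} p⊆q p≢q with any? (λ x → (x ∈? q) ×-dec ¬? (x ∈? p))
... | yes new = p⊆q , new
... | no ¬new = contradiction
  (⊆-antisym p⊆q λ {x} x∈q → decidable-stable (x ∈? p) λ x∉p → ¬new (x , x∈q , x∉p)) p≢q

module _ {n ℓ} {P : Pred (Fin n) ℓ} (P? : Decidable P) where

  comprehension : Subset n
  comprehension = tabulate (does ∘ P?)

  ∈-comprehension⁺ : ∀ {x} → P x → x ∈ comprehension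
  ∈-comprehension⁺ {x} Px = lookup⇒[]= x comprehension
    (trans (lookup∘tabulate (does ∘ P?) x) (dec-true (P? x) Px))

  ∈-comprehension⁻ : ∀ {x} → x ∈ comprehension → P x
  ∈-comprehension⁻ {x} x∈ with P? x | trans (sym (lookup∘tabulate (does ∘ P?) x)) ([]=⇒lookup x∈)
  ... | yes Px | _ = Px
  ... | no _   | ()

-- Makes the choice between a short and a long line: each point supplies one of two alternatives,
-- and one instance of the second is enough.
all-or-any : ∀ {n p q} {P : Pred (Fin n) p} {Q : Pred (Fin n) q} →
  (∀ i → P i ⊎ Q i) → (∀ i → P i) ⊎ (∃[ i ] Q i)
all-or-any {zero}  f = inj₁ λ ()
all-or-any {suc n} f with f zero | all-or-any (f ∘ suc)
... | inj₂ q  | _              = inj₂ (zero , q)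
... | inj₁ _  | inj₂ (i , q)  = inj₂ (suc i , q)
... | inj₁ p₀ | inj₁ p        = inj₁ λ { zero → p₀ ; (suc i) → p i }

two-values : ∀ {a} {A : Set a} {a b x y z : A} →
  x ≡ a ⊎ x ≡ b → y ≡ a ⊎ y ≡ b → z ≡ a ⊎ z ≡ b → x ≡ y ⊎ x ≡ z ⊎ y ≡ z
two-values (inj₁ refl) (inj₁ refl) _           = inj₁ refl
two-values (inj₂ refl) (inj₂ refl) _           = inj₁ refl
two-values (inj₁ refl) _           (inj₁ refl) = inj₂ (inj₁ refl)
two-values (inj₂ refl) _           (inj₂ refl) = inj₂ (inj₁ refl)
two-values _           (inj₁ refl) (inj₁ refl) = inj₂ (inj₂ refl)
two-values _           (inj₂ refl) (inj₂ refl) = inj₂ (inj₂ refl)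

_≟ˢ_ : ∀ {m} (A B : Subset m) → Dec (A ≡ B)
_≟ˢ_ = ≡-dec Bool._≟_

module Transversal {p} {m : ℕ} (𝒞 : Pred (Subset m) p) (𝒞? : Decidable 𝒞) (covers : IsCovering 𝒞)
  (no-twins : ¬ (∃[ u ] ∃[ v ] (u ≢ v × Meeting 𝒞 ⁅ u ⁆ ≐ Meeting 𝒞 ⁅ v ⁆ × HasCard (setoid (Subset m)) (Meeting 𝒞 ⁅ u ⁆) 1)))
  where

  Indep : Pred (Subset m) p
  Indep = PartialTransversal 𝒞

  -- Distinct representatives for two and three points

  Block : Fin m → Set p
  Block u = ∃[ A ] (𝒞 A × u ∈ A)

  -- In the usual notation `𝒞({u}) ⊆ {A, B}`; taking `B = A` says that `u` lies in no member other
  -- than `A`.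
  Confined : Subset m → Subset m → Fin m → Set p
  Confined A B u = ∀ {K} → 𝒞 K → u ∈ K → K ≡ A ⊎ K ≡ B

  confined-or-escapes : ∀ A B u → Confined A B u ⊎ (Σ[ D ∈ Block u ] (proj₁ D ≢ A × proj₁ D ≢ B))
  confined-or-escapes A B u
    with anySubset? (λ K → 𝒞? K ×-dec (u ∈? K) ×-dec ¬? (K ≟ˢ A) ×-dec ¬? (K ≟ˢ B))
  ... | yes (D , D∈ , u∈D , D≢A , D≢B) = inj₂ ((D , D∈ , u∈D) , D≢A , D≢B)
  ... | no none = inj₁ confined
    where
    confined : Confined A B u
    confined {K} K∈ u∈K with K ≟ˢ A | K ≟ˢ B
    ... | yes K≡A | _       = inj₁ K≡A
    ... | no _    | yes K≡B = inj₂ K≡B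
    ... | no K≢A  | no K≢B  = contradiction (K , K∈ , u∈K , K≢A , K≢B) none

  confined? : ∀ A B u → Dec (Confined A B u)
  confined? A B u with confined-or-escapes A B u
  ... | inj₁ conf                             = yes conf
  ... | inj₂ ((D , D∈ , u∈D) , D≢A , D≢B) = no λ conf → [ D≢A , D≢B ]′ (conf D∈ u∈D)

  meets⁻ : ∀ {u K} → Meeting 𝒞 ⁅ u ⁆ K → u ∈ K
  meets⁻ {u} {K} (_ , x , x∈) with x∈K , x∈u ← x∈p∩q⁻ K ⁅ u ⁆ x∈ = subst (_∈ K) (x∈⁅y⁆⇒x≡y u x∈u) x∈K

  meets⁺ : ∀ {u K} → 𝒞 K → u ∈ K → Meeting 𝒞 ⁅ u ⁆ K
  meets⁺ {u} K∈ u∈K = K∈ , u , x∈p∩q⁺ (u∈K , x∈⁅x⁆ u)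

  -- Both points have `{A}` as their set of members, which is the configuration excluded by
  -- `no-twins`.
  twin-free : ∀ {u v A} → u ≢ v → 𝒞 A → u ∈ A → v ∈ A → Confined A A u → Confined A A v → Empty.⊥
  twin-free {u} {v} {A} u≢v A∈ u∈A v∈A conf-u conf-v = no-twins
    ( u , v , u≢v
    , ( (λ K∈ᵤ → subst (Meeting 𝒞 ⁅ v ⁆) (sym (only conf-u K∈ᵤ)) (meets⁺ A∈ v∈A))
      , (λ K∈ᵥ → subst (Meeting 𝒞 ⁅ u ⁆) (sym (only conf-v K∈ᵥ)) (meets⁺ A∈ u∈A)))
    , record
      { to        = λ _ → zero
      ; from      = λ _ → A , meets⁺ A∈ u∈A
      ; to-cong   = λ _ → refl
      ; from-cong = λ _ → refl
      ; inverse   = (λ { {zero} _ → refl }) , λ {K} _ → sym (only conf-u (proj₂ K))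
      })
    where
    only : ∀ {u K} → Confined A A u → Meeting 𝒞 ⁅ u ⁆ K → K ≡ A
    only conf meet = [ id , id ]′ (conf (proj₁ meet) (meets⁻ meet))

  -- If the two chosen blocks coincide, one of the points has another block; otherwise the points
  -- would be twins.
  sdr₂ : ∀ {u v} → u ≢ v → Σ[ α ∈ Block u ] Σ[ β ∈ Block v ] proj₁ α ≢ proj₁ β
  sdr₂ {u} {v} u≢v with α@(A , A∈ , u∈A) ← covers u | β@(B , B∈ , v∈B) ← covers v with A ≟ˢ B
  ... | no A≢B = α , β , A≢B
  ... | yes refl with confined-or-escapes A A u | confined-or-escapes A A v
  ...   | inj₂ (δ , D≢A , _) | _                    = δ , β , D≢A
  ...   | inj₁ _              | inj₂ (δ , D≢A , _) = α , δ , D≢A ∘ sym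
  ...   | inj₁ conf-u          | inj₁ conf-v          = ⊥-elim (twin-free u≢v A∈ u∈A v∈B conf-u conf-v)

  SDR₃ : Fin m → Fin m → Fin m → Set p
  SDR₃ u v w = Σ[ α ∈ Block u ] Σ[ β ∈ Block v ] Σ[ γ ∈ Block w ]
    (proj₁ α ≢ proj₁ β × proj₁ α ≢ proj₁ γ × proj₁ β ≢ proj₁ γ)

  -- An SDR of `v` and `w` gives `w` a block `E` among `A` and `B`. If it leaves `K` free, `u` takes
  -- `K`. Otherwise `v` lies in `K` too, and `u` and `v` share `K` and the one of `A`, `B` that
  -- differs from `E`.
  augment : ∀ {u v w} (α : Block u) (β : Block v) (γ : Block u) → v ≢ w → proj₁ α ≢ proj₁ β →
    proj₁ γ ≢ proj₁ α → proj₁ γ ≢ proj₁ β → Confined (proj₁ α) (proj₁ β) w → SDR₃ u v w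
  augment α@(A , _) β@(B , _) γ@(K , _) v≢w A≢B K≢A K≢B conf
    with β′@(B′ , B′∈ , v∈B′) , ε@(E , E∈ , w∈E) , B′≢E ← sdr₂ v≢w with B′ ≟ˢ K | conf E∈ w∈E
  ... | no B′≢K  | inj₁ refl = γ , β′ , ε , B′≢K ∘ sym , K≢A , B′≢E
  ... | no B′≢K  | inj₂ refl = γ , β′ , ε , B′≢K ∘ sym , K≢B , B′≢E
  ... | yes refl | inj₁ refl = γ , β , ε , K≢B , K≢A , A≢B ∘ sym
  ... | yes refl | inj₂ refl = α , β′ , ε , K≢A ∘ sym , A≢B , B′≢E

  -- The marriage theorem for three points: any two have an SDR, so the only
  -- obstruction is that all three lie in no more than two blocks.
  sdr₃ : ∀ {u v w} → u ≢ v → u ≢ w → v ≢ w →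
    SDR₃ u v w ⊎ (∃[ A ] ∃[ B ] (A ≢ B × Confined A B u × Confined A B v × Confined A B w))
  sdr₃ {u} {v} {w} u≢v u≢w v≢w
    with α@(A , _) , β@(B , _) , A≢B ← sdr₂ u≢v
    with confined-or-escapes A B w
  ... | inj₂ (γ , γ≢A , γ≢B) = inj₁ (α , β , γ , A≢B , γ≢A ∘ sym , γ≢B ∘ sym)
  ... | inj₁ conf-w with confined-or-escapes A B u | confined-or-escapes A B v
  ...   | inj₁ conf-u | inj₁ conf-v = inj₂ (A , B , A≢B , conf-u , conf-v , conf-w)
  ...   | inj₂ (γ , γ≢A , γ≢B) | _ = inj₁ (augment α β γ v≢w A≢B γ≢A γ≢B conf-w)
  ...   | inj₁ _ | inj₂ (γ , γ≢A , γ≢B)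
    with β′ , α′ , γ′ , β≢α , β≢γ , α≢γ ← augment β α γ u≢w (A≢B ∘ sym) γ≢B γ≢A (λ K∈ w∈K → swap (conf-w K∈ w∈K))
    = inj₁ (α′ , β′ , γ′ , β≢α ∘ sym , α≢γ , β≢γ)

  -- Independent sets of at most three points

  matching : ∀ {I} (φ : Fin m → Subset m) → (∀ {e} → e ∈ I → 𝒞 (φ e) × e ∈ φ e) →
    (∀ {e f} → e ∈ I → f ∈ I → φ e ≡ φ f → e ≡ f) → Indep I
  matching φ φ∈ φ-inj = record
    { to        = λ (e , e∈I) → φ e , proj₁ (φ∈ e∈I)
    ; cong      = cong φ
    ; injective = λ {(e , e∈I)} {(f , f∈I)} → φ-inj e∈I f∈I
    } , λ (e , e∈I) → proj₂ (φ∈ e∈I)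

  -- Blocks must differ only when their points do, so repeating a point covers singletons and pairs
  -- as well.
  matching₃ : ∀ {I u v w} (α : Block u) (β : Block v) (γ : Block w) →
    (u ≢ v → proj₁ α ≢ proj₁ β) → (u ≢ w → proj₁ α ≢ proj₁ γ) → (v ≢ w → proj₁ β ≢ proj₁ γ) →
    (∀ {e} → e ∈ I → e ≡ u ⊎ e ≡ v ⊎ e ≡ w) → Indep I
  matching₃ {I} {u} {v} {w} (A , A∈ , u∈A) (B , B∈ , v∈B) (K , K∈ , w∈K) u≢v⇒ u≢w⇒ v≢w⇒ I⊆ =
    matching φ φ∈ φ-inj
    where
    φ : Fin m → Subset m
    φ e with e ≟ᶠ u | e ≟ᶠ v
    ... | yes _ | _     = A
    ... | no _  | yes _ = B
    ... | no _  | no _  = K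

    view : ∀ {e} → e ∈ I → (e ≡ u × φ e ≡ A) ⊎ (e ≡ v × φ e ≡ B) ⊎ (e ≡ w × φ e ≡ K)
    view {e} e∈I with e ≟ᶠ u | e ≟ᶠ v | I⊆ e∈I
    ... | yes e≡u | _       | _                    = inj₁ (e≡u , refl)
    ... | no _    | yes e≡v | _                    = inj₂ (inj₁ (e≡v , refl))
    ... | no _    | no _    | inj₂ (inj₂ e≡w)    = inj₂ (inj₂ (e≡w , refl))
    ... | no e≢u  | no _    | inj₁ e≡u           = contradiction e≡u e≢u
    ... | no _    | no e≢v  | inj₂ (inj₁ e≡v)    = contradiction e≡v e≢v

    φ∈ : ∀ {e} → e ∈ I → 𝒞 (φ e) × e ∈ φ e
    φ∈ e∈I with view e∈I
    ... | inj₁ (refl , eq)        = subst (λ D → 𝒞 D × u ∈ D) (sym eq) (A∈ , u∈A)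
    ... | inj₂ (inj₁ (refl , eq)) = subst (λ D → 𝒞 D × v ∈ D) (sym eq) (B∈ , v∈B)
    ... | inj₂ (inj₂ (refl , eq)) = subst (λ D → 𝒞 D × w ∈ D) (sym eq) (K∈ , w∈K)

    separated : ∀ {x y} {D E : Subset m} → (x ≢ y → D ≢ E) → D ≡ E → x ≡ y
    separated {x} {y} sep D≡E = decidable-stable (x ≟ᶠ y) λ x≢y → sep x≢y D≡E

    φ-inj : ∀ {e f} → e ∈ I → f ∈ I → φ e ≡ φ f → e ≡ f
    φ-inj e∈I f∈I φe≡φf with view e∈I | view f∈I
    ... | inj₁ (refl , _)         | inj₁ (refl , _)         = refl
    ... | inj₁ (refl , p)         | inj₂ (inj₁ (refl , q)) = separated u≢v⇒ (trans (sym p) (trans φe≡φf q))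
    ... | inj₁ (refl , p)         | inj₂ (inj₂ (refl , q)) = separated u≢w⇒ (trans (sym p) (trans φe≡φf q))
    ... | inj₂ (inj₁ (refl , p)) | inj₁ (refl , q)         = sym (separated u≢v⇒ (trans (sym q) (trans (sym φe≡φf) p)))
    ... | inj₂ (inj₁ (refl , _)) | inj₂ (inj₁ (refl , _)) = refl
    ... | inj₂ (inj₁ (refl , p)) | inj₂ (inj₂ (refl , q)) = separated v≢w⇒ (trans (sym p) (trans φe≡φf q))
    ... | inj₂ (inj₂ (refl , p)) | inj₁ (refl , q)         = sym (separated u≢w⇒ (trans (sym q) (trans (sym φe≡φf) p)))
    ... | inj₂ (inj₂ (refl , p)) | inj₂ (inj₁ (refl , q)) = sym (separated v≢w⇒ (trans (sym q) (trans (sym φe≡φf) p)))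
    ... | inj₂ (inj₂ (refl , _)) | inj₂ (inj₂ (refl , _)) = refl

  indep-∅ : Indep ∅
  indep-∅ = matching (λ _ → ∅) (⊥-elim ∘ ∉⊥) (⊥-elim ∘ ∉⊥)

  indep-point : ∀ u → Indep ⁅ u ⁆
  indep-point u = matching₃ (covers u) (covers u) (covers u)
    (contradiction refl) (contradiction refl) (contradiction refl) (inj₁ ∘ x∈⁅y⁆⇒x≡y u)

  ∈-pair⁻ : ∀ {u v e : Fin m} → e ∈ ⁅ u ⁆ ∪ ⁅ v ⁆ → e ≡ u ⊎ e ≡ v
  ∈-pair⁻ {u} {v} e∈ with x∈p∪q⁻ ⁅ u ⁆ ⁅ v ⁆ e∈
  ... | inj₁ e∈u = inj₁ (x∈⁅y⁆⇒x≡y u e∈u)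
  ... | inj₂ e∈v = inj₂ (x∈⁅y⁆⇒x≡y v e∈v)

  ∈-pairˡ : ∀ {u v : Fin m} → u ∈ ⁅ u ⁆ ∪ ⁅ v ⁆
  ∈-pairˡ {u} {v} = p⊆p∪q ⁅ v ⁆ (x∈⁅x⁆ u)

  ∈-pairʳ : ∀ {u v : Fin m} → v ∈ ⁅ u ⁆ ∪ ⁅ v ⁆
  ∈-pairʳ {u} {v} = q⊆p∪q ⁅ u ⁆ ⁅ v ⁆ (x∈⁅x⁆ v)

  ⁅⁆⊆ : ∀ {u : Fin m} {X} → u ∈ X → ⁅ u ⁆ ⊆ X
  ⁅⁆⊆ {u} u∈X e∈ with refl ← x∈⁅y⁆⇒x≡y u e∈ = u∈X

  pair⊆ : ∀ {u v : Fin m} {X} → u ∈ X → v ∈ X → ⁅ u ⁆ ∪ ⁅ v ⁆ ⊆ X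
  pair⊆ u∈X v∈X e∈ with ∈-pair⁻ e∈
  ... | inj₁ refl = u∈X
  ... | inj₂ refl = v∈X

  ∣pair∣ : ∀ {u v : Fin m} → u ≢ v → ∣ ⁅ u ⁆ ∪ ⁅ v ⁆ ∣ ≡ 2
  ∣pair∣ {v = v} u≢v = trans (∣⁅x⁆∪p∣ (x≢y⇒x∉⁅y⁆ u≢v)) (cong suc (∣⁅x⁆∣≡1 v))

  indep-pair : ∀ {u v} → u ≢ v → Indep (⁅ u ⁆ ∪ ⁅ v ⁆)
  indep-pair u≢v with α , β , A≢B ← sdr₂ u≢v =
    matching₃ α β β (λ _ → A≢B) (λ _ → A≢B) (contradiction refl) (λ e∈ → [ inj₁ , inj₂ ∘ inj₁ ]′ (∈-pair⁻ e∈))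

  indep-triple : ∀ {u v w} → SDR₃ u v w → Indep (⁅ w ⁆ ∪ (⁅ u ⁆ ∪ ⁅ v ⁆))
  indep-triple {u} {v} {w} (α , β , γ , A≢B , A≢K , B≢K) =
    matching₃ α β γ (λ _ → A≢B) (λ _ → A≢K) (λ _ → B≢K)
      λ e∈ → [ inj₂ ∘ inj₂ ∘ x∈⁅y⁆⇒x≡y w , (λ e∈′ → [ inj₁ , inj₂ ∘ inj₁ ]′ (∈-pair⁻ e∈′)) ]′ (x∈p∪q⁻ ⁅ w ⁆ _ e∈)

  ∪-⊆ : ∀ {X Y Z : Subset m} → X ⊆ Z → Y ⊆ Z → X ∪ Y ⊆ Z
  ∪-⊆ {X} {Y} X⊆Z Y⊆Z e∈ = [ X⊆Z , Y⊆Z ]′ (x∈p∪q⁻ X Y e∈)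

  -- The set `I` and the bound fix the rank of `X` as `n`. Adding a point of `X` changes nothing,
  -- while a point outside brings an independent set of more than `n` elements and so raises the
  -- rank.
  closed : ∀ {X n I} → Indep I → I ⊆ X → ∣ I ∣ ≡ n → (∀ J → Indep J → J ⊆ X → ∣ J ∣ ≤ n) →
    (∀ {e} → e ∉ X → ∃[ J ] (Indep J × J ⊆ ⁅ e ⁆ ∪ X × n < ∣ J ∣)) → Closed Indep X
  closed {X} {n} {I} I-ind I⊆X ∣I∣≡n bound augmented = cl⊆X , X⊆cl
    where
    cl⊆X : ∀ {e} → cl Indep X e → e ∈ X
    cl⊆X {e} (r , ((I′ , I′-ind , I′⊆X , refl) , _) , (_ , bound′)) = decidable-stable (e ∈? X) λ e∉X →
      let J , J-ind , J⊆ , n<∣J∣ = augmented e∉X in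
      <⇒≱ n<∣J∣ (≤-trans (bound′ J J-ind (subst (J ⊆_) (∪-comm ⁅ e ⁆ X) J⊆)) (bound I′ I′-ind I′⊆X))
    X⊆cl : ∀ {e} → e ∈ X → cl Indep X e
    X⊆cl {e} e∈X = n , ((I , I-ind , I⊆X , ∣I∣≡n) , bound) ,
      ((I , I-ind , p⊆p∪q ⁅ e ⁆ ∘ I⊆X , ∣I∣≡n) , λ J J-ind J⊆ → bound J J-ind (∪-⊆ {X} id (⁅⁆⊆ e∈X) ∘ J⊆))

  -- Flats of rank at most two

  Flat : Set p
  Flat = Σ[ X ∈ Subset m ] Closed Indep X

  empty : Flat
  empty = ∅ , closed indep-∅ id (∣⊥∣≡0 m) (λ J _ J⊆∅ → subst (∣ J ∣ ≤_) (∣⊥∣≡0 m) (p⊆q⇒∣p∣≤∣q∣ J⊆∅))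
    λ {e} _ → ⁅ e ⁆ , indep-point e , p⊆p∪q ∅ , ≤-reflexive (sym (∣⁅x⁆∣≡1 e))

  point : Fin m → Flat
  point u = ⁅ u ⁆ , closed (indep-point u) id (∣⁅x⁆∣≡1 u) (λ J _ J⊆u → subst (∣ J ∣ ≤_) (∣⁅x⁆∣≡1 u) (p⊆q⇒∣p∣≤∣q∣ J⊆u))
    λ {e} e∉u → ⁅ e ⁆ ∪ ⁅ u ⁆ , indep-pair (x∉⁅y⁆⇒x≢y e∉u) , id , ≤-reflexive (sym (∣pair∣ (x∉⁅y⁆⇒x≢y e∉u)))

  -- `X` is the complement of the union of all members of `𝒞` other than the distinct sets `A` and
  -- `B`.
  Span : Subset m → Subset m → Subset m → Set p
  Span A B X = A ≢ B × (∀ {e} → e ∈ X → Confined A B e) × (∀ {e} → Confined A B e → e ∈ X)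

  -- The alternatives overlap: a set of the second kind may still consist of `u` and `v` alone.
  Shape : Fin m → Fin m → Subset m → Set p
  Shape u v X = (∀ {e} → e ∈ X → e ≡ u ⊎ e ≡ v)
    ⊎ (∃[ A ] ∃[ B ] Span A B X)

  record Line (u v : Fin m) : Set p where
    field
      flat  : Flat
      u∈    : u ∈ proj₁ flat
      v∈    : v ∈ proj₁ flat
      rank₂ : ∀ J → Indep J → J ⊆ proj₁ flat → ∣ J ∣ ≤ 2
      shape : Shape u v (proj₁ flat)

  -- Every further point is independent of `u` and `v`, so the pair is already closed.
  short-line : ∀ {u v} → u ≢ v → (∀ w → (w ≡ u ⊎ w ≡ v) ⊎ SDR₃ u v w) → Line u v
  short-line {u} {v} u≢v free = record
    { flat  = ⁅ u ⁆ ∪ ⁅ v ⁆ , closed (indep-pair u≢v) id (∣pair∣ u≢v) rank₂ extend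
    ; u∈    = ∈-pairˡ
    ; v∈    = ∈-pairʳ
    ; rank₂ = rank₂
    ; shape = inj₁ ∈-pair⁻
    }
    where
    rank₂ : ∀ J → Indep J → J ⊆ ⁅ u ⁆ ∪ ⁅ v ⁆ → ∣ J ∣ ≤ 2
    rank₂ J _ J⊆ = subst (∣ J ∣ ≤_) (∣pair∣ u≢v) (p⊆q⇒∣p∣≤∣q∣ J⊆)
    extend : ∀ {e} → e ∉ ⁅ u ⁆ ∪ ⁅ v ⁆ → ∃[ J ] (Indep J × J ⊆ ⁅ e ⁆ ∪ (⁅ u ⁆ ∪ ⁅ v ⁆) × 2 < ∣ J ∣)
    extend {e} e∉ with free e
    ... | inj₁ (inj₁ refl) = contradiction ∈-pairˡ e∉
    ... | inj₁ (inj₂ refl) = contradiction (∈-pairʳ {u}) e∉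
    ... | inj₂ sdr = _ , indep-triple sdr , id ,
      ≤-reflexive (sym (trans (∣⁅x⁆∪p∣ e∉) (cong suc (∣pair∣ u≢v))))

  -- An independent set inside `X` is matched injectively into `{A, B}`, so it has at most two
  -- elements. A point outside `X` has a third block, while `u` and `v` are represented by `A` and
  -- `B`.
  long-line : ∀ {u v A B} → u ≢ v → A ≢ B → Confined A B u → Confined A B v → Line u v
  long-line {u} {v} {A} {B} u≢v A≢B conf-u conf-v = record
    { flat  = X , closed (indep-pair u≢v) pair⊆X (∣pair∣ u≢v) rank₂ extend
    ; u∈    = ∈X⁺ conf-u
    ; v∈    = ∈X⁺ conf-v
    ; rank₂ = rank₂
    ; shape = inj₂ (A , B , A≢B , ∈X⁻ , ∈X⁺)
    }
    where
    X = comprehension (confined? A B)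
    ∈X⁺ : ∀ {e} → Confined A B e → e ∈ X
    ∈X⁺ = ∈-comprehension⁺ (confined? A B)
    ∈X⁻ : ∀ {e} → e ∈ X → Confined A B e
    ∈X⁻ = ∈-comprehension⁻ (confined? A B)
    pair⊆X : ⁅ u ⁆ ∪ ⁅ v ⁆ ⊆ X
    pair⊆X = pair⊆ (∈X⁺ conf-u) (∈X⁺ conf-v)
    rank₂ : ∀ J → Indep J → J ⊆ X → ∣ J ∣ ≤ 2
    rank₂ J (φ , φ∋) J⊆X with 3 ≤? ∣ J ∣
    ... | no 3≰ = ≤-pred (≰⇒> 3≰)
    ... | yes 3≤ with x , y , z , x≢y , x≢z , y≢z , x∈J , y∈J , z∈J ← pick₃ 3≤
                 with two-values (value x∈J) (value y∈J) (value z∈J)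
      where
      value : ∀ {e} (e∈J : e ∈ J) → proj₁ (Injection.to φ (e , e∈J)) ≡ A ⊎ proj₁ (Injection.to φ (e , e∈J)) ≡ B
      value {e} e∈J = ∈X⁻ (J⊆X e∈J) (proj₂ (Injection.to φ (e , e∈J))) (φ∋ (e , e∈J))
    ...   | inj₁ eq        = contradiction (Injection.injective φ eq) x≢y
    ...   | inj₂ (inj₁ eq) = contradiction (Injection.injective φ eq) x≢z
    ...   | inj₂ (inj₂ eq) = contradiction (Injection.injective φ eq) y≢z
    extend : ∀ {e} → e ∉ X → ∃[ J ] (Indep J × J ⊆ ⁅ e ⁆ ∪ X × 2 < ∣ J ∣)
    extend {e} e∉X with confined-or-escapes A B e | sdr₂ u≢v
    ... | inj₁ conf | _ = contradiction (∈X⁺ conf) e∉X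
    ... | inj₂ (δ , D≢A , D≢B) | α@(_ , A′∈ , u∈A′) , β@(_ , B′∈ , v∈B′) , A′≢B′ =
      _ , indep-triple (α , β , δ , A′≢B′ , avoids (conf-u A′∈ u∈A′) , avoids (conf-v B′∈ v∈B′))
        , ∪-⊆ {⁅ e ⁆} (p⊆p∪q X) (q⊆p∪q ⁅ e ⁆ X ∘ pair⊆X)
        , ≤-reflexive (sym (trans (∣⁅x⁆∪p∣ (e∉X ∘ pair⊆X)) (cong suc (∣pair∣ u≢v))))
      where
      avoids : ∀ {K} → K ≡ A ⊎ K ≡ B → K ≢ proj₁ δ
      avoids (inj₁ refl) = D≢A ∘ sym
      avoids (inj₂ refl) = D≢B ∘ sym

  -- Abstract, since unfolding the proof terms inside a line is very expensive.
  abstract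
    line : ∀ {u v} → u ≢ v → Line u v
    line {u} {v} u≢v with all-or-any free-or-confined
      where
      free-or-confined : ∀ w → ((w ≡ u ⊎ w ≡ v) ⊎ SDR₃ u v w)
                             ⊎ (∃[ A ] ∃[ B ] (A ≢ B × Confined A B u × Confined A B v))
      free-or-confined w with w ≟ᶠ u | w ≟ᶠ v
      ... | yes w≡u | _       = inj₁ (inj₁ (inj₁ w≡u))
      ... | no _    | yes w≡v = inj₁ (inj₁ (inj₂ w≡v))
      ... | no w≢u  | no w≢v with sdr₃ u≢v (w≢u ∘ sym) (w≢v ∘ sym)
      ...   | inj₁ sdr = inj₁ (inj₂ sdr)
      ...   | inj₂ (A , B , A≢B , conf-u , conf-v , _) = inj₂ (A , B , A≢B , conf-u , conf-v)
    ... | inj₁ free = short-line u≢v free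
    ... | inj₂ (_ , A , B , A≢B , conf-u , conf-v) = long-line u≢v A≢B conf-u conf-v

-- The lattice of flats

module Geometry {p} {m : ℕ} (𝒞 : Pred (Subset m) p) (𝒞? : Decidable 𝒞) (covers : IsCovering 𝒞)
  (no-twins : ¬ (∃[ u ] ∃[ v ] (u ≢ v × Meeting 𝒞 ⁅ u ⁆ ≐ Meeting 𝒞 ⁅ v ⁆ × HasCard (setoid (Subset m)) (Meeting 𝒞 ⁅ u ⁆) 1)))
  (meets : HasMeets (L 𝒞))
  where

  open Transversal 𝒞 𝒞? covers no-twins
  open Poset (L 𝒞) using () renaming (_≤_ to _≼_)

  _≺_ : Flat → Flat → Set
  F ≺ G = proj₁ F ⊆ proj₁ G × proj₁ F ≢ proj₁ G

  ≺-size : ∀ {F G} → F ≺ G → suc ∣ proj₁ F ∣ ≤ ∣ proj₁ G ∣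
  ≺-size (F⊆G , F≢G) = p⊂q⇒∣p∣<∣q∣ (⊆∧≢⇒⊂ F⊆G F≢G)

  -- Flats grow strictly along a chain, so cardinality bounds height.
  chain-size : ∀ {F G n} → Chain (L 𝒞) F G n → n + ∣ proj₁ F ∣ ≤ ∣ proj₁ G ∣
  chain-size (stop refl) = ≤-refl
  chain-size {F} {n = suc n} (step {y = Y} F≺Y ch) = ≤-trans
    (≤-trans (≤-reflexive (sym (+-suc n ∣ proj₁ F ∣))) (+-monoʳ-≤ n (≺-size {F} {Y} F≺Y))) (chain-size ch)

  empty≺ : ∀ {F : Flat} {u} → u ∈ proj₁ F → empty ≺ F
  empty≺ {F} u∈F = ⊆-min (proj₁ F) , λ { refl → ∉⊥ u∈F }

  -- `HasHeight` names its own minimum `B`; being contained in `empty`, it has no points.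
  min≺ : ∀ {B F : Flat} {u} → Minimum _≼_ B → u ∈ proj₁ F → B ≺ F
  min≺ {B} {F} min u∈F = min F , λ { refl → ∉⊥ (min empty u∈F) }

  point≺ : ∀ {u v F} → u ≢ v → u ∈ proj₁ F → v ∈ proj₁ F → point u ≺ F
  point≺ {u} {v} u≢v u∈F v∈F = ⁅⁆⊆ u∈F , λ { refl → u≢v (sym (x∈⁅y⁆⇒x≡y u v∈F)) }

  point-height : ∀ u → HasHeight (L 𝒞) (point u) 1
  point-height u = empty , (λ F → ⊆-min (proj₁ F)) ,
    step {y = point u} (empty≺ {point u} (x∈⁅x⁆ u)) (stop refl) ,
    λ n ch → ≤-trans (≤-trans (m≤m+n n ∣ ∅ {m} ∣) (chain-size ch)) (≤-reflexive (∣⁅x⁆∣≡1 u))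

  height-size : ∀ {F k} → HasHeight (L 𝒞) F k → k ≤ ∣ proj₁ F ∣
  height-size {k = k} (B , _ , ch , _) = ≤-trans (m≤m+n k ∣ proj₁ B ∣) (chain-size ch)

  height₁⇒point : ∀ {F} → HasHeight (L 𝒞) F 1 → ∃[ u ] proj₁ F ≡ ⁅ u ⁆
  height₁⇒point {F} h@(B , min , _ , bound) with u , _ , u∈F , _ ← pick (height-size {F} h) =
    u , sym (decidable-stable (⁅ u ⁆ ≟ˢ proj₁ F) λ u≢F →
      1+n≰n (bound 2 (step {y = point u} (min≺ {B} {point u} min (x∈⁅x⁆ u))
                     (step {y = F} ((⁅⁆⊆ u∈F) , u≢F) (stop refl)))))

  module _ {u v : Fin m} (u≢v : u ≢ v) where
    open Line (line u≢v)

    -- Two points of `Z` already give it rank 2, the rank of the line, so every point of the line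
    -- lies in the closure of `Z`.
    line-minimal : ∀ (Z : Flat) → 2 ≤ ∣ proj₁ Z ∣ → proj₁ Z ⊆ proj₁ flat → proj₁ Z ≡ proj₁ flat
    line-minimal (Z , cl⊆Z , _) 2≤ Z⊆ℓ with x , y , x≢y , x∈Z , y∈Z ← pick₂ 2≤ = ⊆-antisym Z⊆ℓ λ {e} e∈ℓ → cl⊆Z
      ( 2
      , ((_ , indep-pair x≢y , pair⊆ x∈Z y∈Z , ∣pair∣ x≢y) , λ J J-ind J⊆Z → rank₂ J J-ind (Z⊆ℓ ∘ J⊆Z))
      , ((_ , indep-pair x≢y , p⊆p∪q ⁅ e ⁆ ∘ pair⊆ x∈Z y∈Z , ∣pair∣ x≢y)
        , λ J J-ind J⊆Z∪e → rank₂ J J-ind (∪-⊆ {Z} Z⊆ℓ (⁅⁆⊆ e∈ℓ) ∘ J⊆Z∪e)))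

    line-height : HasHeight (L 𝒞) flat 2
    line-height = empty , (λ F → ⊆-min (proj₁ F)) ,
      step {y = point u} (empty≺ {point u} (x∈⁅x⁆ u)) (step {y = flat} (point≺ {F = flat} u≢v u∈ v∈) (stop refl)) ,
      bound
      where
      bound : ∀ n → Chain (L 𝒞) empty flat n → n ≤ 2
      bound 0 _ = z≤n
      bound 1 _ = s≤s z≤n
      bound 2 _ = ≤-refl
      -- After two steps `Z` has at least two points and hence is the whole line, so the chain
      -- cannot go on.
      bound (suc (suc (suc n))) (step {y = Y} ∅≺Y (step {y = Z} Y≺Z ch)) = contradiction (chain-size ch) (<⇒≱ (let open ≤-Reasoning in begin-strict
        ∣ proj₁ flat ∣      ≡⟨ cong ∣_∣ Z≡ℓ ⟨
        ∣ proj₁ Z ∣         <⟨ m<n+m ∣ proj₁ Z ∣ (s≤s z≤n) ⟩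
        suc n + ∣ proj₁ Z ∣ ∎))
        where
        Z≡ℓ : proj₁ Z ≡ proj₁ flat
        Z≡ℓ = line-minimal Z
          (≤-trans (m≤m+n 2 ∣ ∅ {m} ∣) (chain-size {empty} {Z} (step {y = Y} ∅≺Y (step {y = Z} Y≺Z (stop refl)))))
          (chain⇒≤ (L 𝒞) ch)

    -- The meet of `F` with the line contains `u` and `v`, so by `line-minimal` it is the whole
    -- line.
    line⊆ : ∀ (F : Flat) → u ∈ proj₁ F → v ∈ proj₁ F → proj₁ flat ⊆ proj₁ F
    line⊆ F u∈F v∈F with Z , Z⊆F , Z⊆ℓ , greatest ← meets F flat =
      subst (_⊆ proj₁ F) (line-minimal Z 2≤∣Z∣ Z⊆ℓ) Z⊆F
      where
      2≤∣Z∣ : 2 ≤ ∣ proj₁ Z ∣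
      2≤∣Z∣ = subst (_≤ ∣ proj₁ Z ∣) (∣pair∣ u≢v) (p⊆q⇒∣p∣≤∣q∣ (pair⊆
        (greatest (point u) (⁅⁆⊆ u∈F) (⁅⁆⊆ u∈) (x∈⁅x⁆ u)) (greatest (point v) (⁅⁆⊆ v∈F) (⁅⁆⊆ v∈) (x∈⁅x⁆ v))))

    -- Otherwise the minimum, a point, the line and `F` would form a chain of length 3 up to a flat
    -- of height 2.
    line-unique : ∀ (F : Flat) → HasHeight (L 𝒞) F 2 → u ∈ proj₁ F → v ∈ proj₁ F → proj₁ F ≡ proj₁ flat
    line-unique F (B , min , _ , bound) u∈F v∈F = sym (decidable-stable (proj₁ flat ≟ˢ proj₁ F) λ ℓ≢F →
      1+n≰n (bound 3 (step {y = point u} (min≺ {B} {point u} min (x∈⁅x⁆ u))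
                     (step {y = flat} (point≺ {F = flat} u≢v u∈ v∈)
                     (step {y = F} (line⊆ F u∈F v∈F , ℓ≢F) (stop refl))))))

  -- A cover of the point `u` has a second point `v`, and the line through both cannot lie strictly
  -- in between, so it equals the cover. Flats are compared as subsets, hence the height is stated
  -- for a flat with the same points.
  cover⇒line : ∀ {u} (Y : Flat) → Cov (L 𝒞) (point u) Y → ∃[ F ] (HasHeight (L 𝒞) F 2 × proj₁ F ≡ proj₁ Y)
  cover⇒line {u} Y ((u⊆Y , u≢Y) , none) with _ , v , v∈Y , v∉u ← ⊆∧≢⇒⊂ u⊆Y u≢Y =
    flat , line-height u≢v , decidable-stable (proj₁ flat ≟ˢ proj₁ Y) λ ℓ≢Y →
      none (flat , point≺ {F = flat} u≢v u∈ v∈ , line⊆ u≢v Y (u⊆Y (x∈⁅x⁆ u)) v∈Y , ℓ≢Y)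
    where
    u≢v : u ≢ v
    u≢v refl = v∉u (x∈⁅x⁆ u)
    open Line (line u≢v)

  line⇒cover : ∀ {u} (F : Flat) → HasHeight (L 𝒞) F 2 → u ∈ proj₁ F → Cov (L 𝒞) (point u) F
  line⇒cover {u} F h@(B , min , _ , bound) u∈F =
    (⁅⁆⊆ u∈F , λ u≡F → 1+n≰n (subst (2 ≤_) (trans (cong ∣_∣ (sym u≡F)) (∣⁅x⁆∣≡1 u)) (height-size {F} h))) ,
    λ (Z , u≺Z , Z≺F) → 1+n≰n (bound 3
      (step {y = point u} (min≺ {B} {point u} min (x∈⁅x⁆ u)) (step {y = Z} u≺Z (step {y = F} Z≺F (stop refl)))))

  -- The special point of a long line

  third-point : ∀ {u v w X} → u ≢ w → v ≢ w → w ∈ X → Shape u v X → ∃[ A ] ∃[ B ] Span A B X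
  third-point _   _   _   (inj₂ span)  = span
  third-point u≢w v≢w w∈X (inj₁ short) = ⊥-elim ([ u≢w ∘ sym , v≢w ∘ sym ]′ (short w∈X))

  long-span : ∀ (F : Flat) → HasHeight (L 𝒞) F 2 → 3 ≤ ∣ proj₁ F ∣ → ∃[ A ] ∃[ B ] Span A B (proj₁ F)
  long-span F h 3≤ =
    let u , v , _ , u≢v , u≢w , v≢w , u∈F , v∈F , w∈F = pick₃ 3≤
        F≡ℓ = line-unique u≢v F h u∈F v∈F
    in third-point u≢w v≢w w∈F (subst (Shape u v) (sym F≡ℓ) (Line.shape (line u≢v)))

  Only : Fin m → Subset m → Set p
  Only u A = 𝒞 A × u ∈ A × Confined A A u

  Both : Subset m → Subset m → Fin m → Set p
  Both A B u = (𝒞 A × u ∈ A) × (𝒞 B × u ∈ B)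

  classify : ∀ {A B u} → Confined A B u → Both A B u ⊎ Only u A ⊎ Only u B
  classify {A} {B} {u} conf with 𝒞? A ×-dec (u ∈? A) | 𝒞? B ×-dec (u ∈? B)
  ... | yes a        | yes b        = inj₁ (a , b)
  ... | yes (A∈ , u∈A) | no ¬b      = inj₂ (inj₁ (A∈ , u∈A , λ K∈ u∈K →
    [ inj₁ , (λ { refl → contradiction (K∈ , u∈K) ¬b }) ]′ (conf K∈ u∈K)))
  ... | no ¬a        | yes (B∈ , u∈B) = inj₂ (inj₂ (B∈ , u∈B , λ K∈ u∈K →
    [ (λ { refl → contradiction (K∈ , u∈K) ¬a }) , inj₂ ]′ (conf K∈ u∈K)))
  ... | no ¬a        | no ¬b with K , K∈ , u∈K ← covers u with conf K∈ u∈K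
  ...   | inj₁ refl = contradiction (K∈ , u∈K) ¬a
  ...   | inj₂ refl = contradiction (K∈ , u∈K) ¬b

  only-unique : ∀ {u v A} → u ≢ v → Only u A → Only v A → Empty.⊥
  only-unique u≢v (A∈ , u∈A , conf-u) (_ , v∈A , conf-v) = twin-free u≢v A∈ u∈A v∈A conf-u conf-v

  -- At most one point lies in A only and at most one in B only, so a third point lies in both.
  long⇒both : ∀ {A B X} → Span A B X → 3 ≤ ∣ X ∣ → ∃[ u ] (u ∈ X × Both A B u)
  long⇒both (_ , confined , _) 3≤
    with u , v , w , u≢v , u≢w , v≢w , u∈X , v∈X , w∈X ← pick₃ 3≤
    with classify (confined u∈X) | classify (confined v∈X) | classify (confined w∈X)
  ... | inj₁ both       | _               | _               = u , u∈X , both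
  ... | _               | inj₁ both       | _               = v , v∈X , both
  ... | _               | _               | inj₁ both       = w , w∈X , both
  ... | inj₂ (inj₁ u∈) | inj₂ (inj₁ v∈) | _               = ⊥-elim (only-unique u≢v u∈ v∈)
  ... | inj₂ (inj₂ u∈) | inj₂ (inj₂ v∈) | _               = ⊥-elim (only-unique u≢v u∈ v∈)
  ... | inj₂ (inj₁ u∈) | _               | inj₂ (inj₁ w∈) = ⊥-elim (only-unique u≢w u∈ w∈)
  ... | inj₂ (inj₂ u∈) | _               | inj₂ (inj₂ w∈) = ⊥-elim (only-unique u≢w u∈ w∈)
  ... | _               | inj₂ (inj₁ v∈) | inj₂ (inj₁ w∈) = ⊥-elim (only-unique v≢w v∈ w∈)
  ... | _               | inj₂ (inj₂ v∈) | inj₂ (inj₂ w∈) = ⊥-elim (only-unique v≢w v∈ w∈)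

  -- Since `u` lies in the distinct members `A` and `B` and is confined to `A′` and `B′`, the two
  -- pairs of blocks coincide.
  span-unique : ∀ {A B A′ B′ X Y u} → Span A B X → Span A′ B′ Y → Both A B u → u ∈ Y → Y ≡ X
  span-unique (A≢B , X⇒ , X⇐) (_ , Y⇒ , Y⇐) ((A∈ , u∈A) , (B∈ , u∈B)) u∈Y
    with Y⇒ u∈Y A∈ u∈A | Y⇒ u∈Y B∈ u∈B
  ... | inj₁ refl | inj₁ refl = contradiction refl A≢B
  ... | inj₂ refl | inj₂ refl = contradiction refl A≢B
  ... | inj₁ refl | inj₂ refl = ⊆-antisym (λ e∈ → X⇐ (Y⇒ e∈)) (λ e∈ → Y⇐ (X⇒ e∈))
  ... | inj₂ refl | inj₁ refl = ⊆-antisym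
    (λ e∈ → X⇐ λ K∈ e∈K → swap (Y⇒ e∈ K∈ e∈K))
    (λ e∈ → Y⇐ λ K∈ e∈K → swap (X⇒ e∈ K∈ e∈K))

  -- Points and flats of rank 2 as a linear space

  module Count {n c : ℕ} (card₂ : Card (L 𝒞) (OfRank (L 𝒞) 2) n) (cardᶜ : ∀ u → Card (L 𝒞) (Cov (L 𝒞) (point u)) c) where
    private module I = Inverse card₂

    F : Fin n → Flat
    F i = proj₁ (I.from i)

    F-height : ∀ i → HasHeight (L 𝒞) (F i) 2
    F-height i = proj₂ (I.from i)

    S : Fin n → Subset m
    S i = proj₁ (F i)

    S-injective : ∀ {i j} → S i ≡ S j → i ≡ j
    S-injective {i} {j} eq = trans (sym (I.strictlyInverseˡ i)) (trans (I.to-cong eq) (I.strictlyInverseˡ j))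

    S-index : ∀ {G} (h : HasHeight (L 𝒞) G 2) → S (I.to (G , h)) ≡ proj₁ G
    S-index h = I.strictlyInverseʳ (_ , h)

    joins : ∀ u v → u ≢ v → ∃[ i ] (u ∈ S i × v ∈ S i × (∀ j → u ∈ S j → v ∈ S j → j ≡ i))
    joins u v u≢v = I.to (flat , line-height u≢v) , subst (u ∈_) (sym S≡ℓ) u∈ , subst (v ∈_) (sym S≡ℓ) v∈ ,
      λ j u∈S v∈S → S-injective (trans (line-unique u≢v (F j) (F-height j) u∈S v∈S) (sym S≡ℓ))
      where
      open Line (line u≢v)
      S≡ℓ : S (I.to (flat , line-height u≢v)) ≡ proj₁ flat
      S≡ℓ = S-index {flat} (line-height u≢v)

    -- Covers of the point `u` are exactly the lines through `u`, so `count-image` applies to the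
    -- map that sends a cover to the index of its line.
    degree : ∀ u → sum (λ i → χ (lookup (S i) u)) ≡ c
    degree u = count-image (λ i → lookup (S i) u) h h-injective
      (λ j → []=⇒lookup (subst (u ∈_) (sym (S-h j)) (proj₁ (proj₁ (proj₂ (K.from j))) (x∈⁅x⁆ u))))
      (λ i u∈S → let cov = line⇒cover (F i) (F-height i) (lookup⇒[]= u (S i) u∈S) in
        K.to (F i , cov) , S-injective (trans (S-h _) (K.strictlyInverseʳ (F i , cov))))
      where
      module K = Inverse (cardᶜ u)
      found : ∀ j → ∃[ G ] (HasHeight (L 𝒞) G 2 × proj₁ G ≡ proj₁ (proj₁ (K.from j)))
      found j = cover⇒line (proj₁ (K.from j)) (proj₂ (K.from j))
      h : Fin c → Fin n
      h j = I.to (proj₁ (found j) , proj₁ (proj₂ (found j)))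
      S-h : ∀ j → S (h j) ≡ proj₁ (proj₁ (K.from j))
      S-h j = trans (S-index {proj₁ (found j)} (proj₁ (proj₂ (found j)))) (proj₂ (proj₂ (found j)))
      h-injective : ∀ {i j} → h i ≡ h j → i ≡ j
      h-injective {i} {j} eq = trans (sym (K.strictlyInverseˡ i))
        (trans (K.to-cong (trans (sym (S-h i)) (trans (cong S eq) (S-h j)))) (K.strictlyInverseˡ j))

    -- The special point lies in both blocks of its line; a second long line through it would be
    -- spanned by the same pair.
    special : ∀ i → 3 ≤ ∣ S i ∣ → ∃[ u ] (u ∈ S i × (∀ j → u ∈ S j → 3 ≤ ∣ S j ∣ → j ≡ i))
    special i 3≤ =
      let _ , _ , span = long-span (F i) (F-height i) 3≤
          u , u∈S , both = long⇒both span 3≤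
      in u , u∈S , λ j u∈Sj 3≤j →
        let _ , _ , span′ = long-span (F j) (F-height j) 3≤j
        in S-injective (span-unique span span′ both u∈Sj)

    open LinearSpace S joins degree (λ i → height-size {F i} (F-height i)) special public using (degree<; line-count)

  -- The flats of rank 1 are the singletons, which gives injections between `Fin a` and `Fin m` in
  -- both directions.
  card₁ : ∀ {a} → Card (L 𝒞) (OfRank (L 𝒞) 1) a → a ≡ m
  card₁ {a} card = cantor-schröder-bernstein
    {f = λ j → proj₁ (found j)} {g = λ u → I.to (point u , point-height u)}
    (λ {i} {j} eq → trans (sym (I.strictlyInverseˡ i))
      (trans (I.to-cong (trans (proj₂ (found i)) (trans (cong ⁅_⁆ eq) (sym (proj₂ (found j)))))) (I.strictlyInverseˡ j)))
    (λ {u} {v} eq → x∈⁅y⁆⇒x≡y v (subst (u ∈_)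
      (trans (sym (I.strictlyInverseʳ (point u , point-height u)))
        (trans (I.from-cong eq) (I.strictlyInverseʳ (point v , point-height v)))) (x∈⁅x⁆ u)))
    where
    module I = Inverse card
    found : ∀ j → ∃[ u ] proj₁ (proj₁ (I.from j)) ≡ ⁅ u ⁆
    found j = height₁⇒point {proj₁ (I.from j)} (proj₂ (I.from j))

-- The line count transported to the uniform lattice

theorem4p9 : ∀ {p q ℓ₁ ℓ₂} (m : ℕ) (𝒞 : Pred (Subset m) p) → Decidable 𝒞 → IsCovering 𝒞 →
    ¬ (∃[ u ] ∃[ v ] (u ≢ v × Meeting 𝒞 ⁅ u ⁆ ≐ Meeting 𝒞 ⁅ v ⁆ × HasCard (setoid (Subset m)) (Meeting 𝒞 ⁅ u ⁆) 1)) →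
    (𝓛 : Lattice q ℓ₁ ℓ₂) → IsUniform 𝓛 → L 𝒞 ≅ Lattice.poset 𝓛 →
    (n₂ : ℕ) → Card (L 𝒞) (OfRank (L 𝒞) 2) n₂ → n₂ < m C 2 →
    (π : Lattice.Carrier 𝓛) → Atom (Lattice.poset 𝓛) π →
    (a c : ℕ) → Card (Lattice.poset 𝓛) (OfRank (Lattice.poset 𝓛) 1) a →
    Card (Lattice.poset 𝓛) (Cov (Lattice.poset 𝓛) π) c →
    Card (Lattice.poset 𝓛) (OfRank (Lattice.poset 𝓛) 2) n₂
    × c ≤ a
    × ι n₂ ≡ ι (a C 2) - (ι (suc (a ∸ c) C 2) - ι 1) * (+ a / suc (a ∸ c))
theorem4p9 m 𝒞 𝒞? covers no-twins 𝓛 (ranked , same) iso@(f , isIso) n₂ card₂ _ π (⊥ , min , ⊥⋖π) a c cardₐ cardᶜ =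
  go (card₁ (Composition.inverse (ranks-↔ {P = L 𝒞} {Q = P} iso 1) cardₐ)) cardₐ
  where
  P = Lattice.poset 𝓛
  open Lattice 𝓛 using (_∧_; x∧y≤x; x∧y≤y; ∧-greatest; module Eq) renaming (trans to ≤-trans′; reflexive to ≤-reflexive′)
  open IsOrderIsomorphism isIso using (mono; cancel; surjective)

  meets : HasMeets (L 𝒞)
  meets F G = let Z , f-Z = surjective (f F ∧ f G) ; fZ≈ = f-Z {Z} refl in
    Z , cancel {Z} {F} (≤-trans′ (≤-reflexive′ fZ≈) (x∧y≤x (f F) (f G)))
      , cancel {Z} {G} (≤-trans′ (≤-reflexive′ fZ≈) (x∧y≤y (f F) (f G)))
      , λ W W⊆F W⊆G → cancel {W} {Z} (≤-trans′ (∧-greatest (mono {W} {F} W⊆F) (mono {W} {G} W⊆G)) (≤-reflexive′ (Eq.sym fZ≈)))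

  open Transversal 𝒞 𝒞? covers no-twins using (point)
  open Geometry 𝒞 𝒞? covers no-twins meets

  π-height : HasHeight P π 1
  π-height = proj₂ ranked ⊥ π 0 ⊥⋖π (minimum-height P min)

  -- The image of the point and `π` both have rank 1, so uniformity gives them equally many covers,
  -- namely `c`.
  cover-card : ∀ u → Card (L 𝒞) (Cov (L 𝒞) (point u)) c
  cover-card u = Composition.inverse (covers-↔ {P = L 𝒞} {Q = P} iso (point u))
    (Composition.inverse (same (f (point u)) π 1 (height-mono {P = L 𝒞} {Q = P} iso (point-height u)) π-height) cardᶜ)

  open Count card₂ cover-card

  -- Identifies `m` with the number `a` of atoms, in which the formula is stated.
  go : a ≡ m → Card P (OfRank P 1) a → _
  go refl card = Composition.inverse (Symmetry.inverse (ranks-↔ {P = L 𝒞} {Q = P} iso 2)) card₂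
    , <⇒≤ (degree< u)
    , rational-form n₂ (a C 2) (suc (a ∸ c) C 2) a (a ∸ c) (binomial-form n₂ a (suc (a ∸ c)) (line-count u))
    where
    -- The atom `π` shows that the ground set is inhabited.
    u : Fin a
    u = Inverse.to card (π , π-height)
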